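{- Let $\lambda$ be a partition and $n\ge\ell(\lambda)$. The maps \[\mathrm{mlq}=\rho\circ\mathrm{revcrw}:\mathrm{SSYT}(\lambda,n)\to\mathrm{MLQ}_0(\lambda,n),\qquad \mathrm{tab}=\mathrm{Icol}\circ\mathrm{rw}:\mathrm{MLQ}_0(\lambda,n)\to\mathrm{SSYT}(\lambda,n)\] are well defined and mutually inverse bijections.
   Context: $\mathrm{SSYT}(\lambda,n)$: semistandard tableaux of shape $\lambda$ (French notation: row $r$ from the bottom has $\lambda_r$ boxes; rows weakly increase left to right, columns strictly increase bottom to top) with entries in $[n]$. The column reading word $\mathrm{crw}(T)$ reads the columns from left to right, each from top to bottom; $\mathrm{revcrw}(T)$ is its reverse. For a word $w=w_1\cdots w_k$, $\mathrm{Icol}(w)=w_k\to(\cdots\to(w_1\to\emptyset))$, where $x\to T$ is Schensted column insertion: $x$ is inserted in the first column; if $x$ exceeds all its entries it is placed at the top of the column, otherwise it replaces the smallest entry $\ge x$ of the column, and the replaced entry is inserted into the next column in the same way. Multiline queues: a multiline queue of shape $\lambda$ on $n$ columns is a tuple $(B_1,\dots,B_{\lambda_1})$ of subsets of $[n]$ with $|B_r|=\lambda'_r$, drawn with rows bottom to top and columns left to right (ball at $(r,j)$ iff $j\in B_r$); tuples with weakly decreasing row sizes are identified with multiline queues of the corresponding shape after deleting trailing empty rows. $\mathrm{rw}(M)$ records column numbers of balls scanning rows bottom to top, each row left to right. Ferrari–Martin labelling: for $r$ from the top row down to $2$, unlabelled balls of row $r$ get label $r$; balls of row $r$, by decreasing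 label and left to right among ties, are each paired with the first not yet labelled ball of row $r-1$ weakly to the right, cyclically (column $n$ to column $1$), getting the same label; a pairing wraps if it passes from column $n$ to column $1$; $\mathrm{maj}=\sum(\ell-r+1)$ over wrapping pairings. $\mathrm{MLQ}_0(\lambda,n)$: those of shape $\lambda$ with $\mathrm{maj}=0$. Collapsing: $\mathrm{cw}(B)$ records row numbers of balls scanning columns left to right, each top to bottom; $\mathrm{Par}_i(w)$ writes "(" for each $i+1$ and ")" for each $i$ read left to right, matching iteratively when "(" is immediately followed by ")" or separated only by matched parentheses; a ball of row $i+1$ is unmatched above if its letter is unmatched in $\mathrm{Par}_i(\mathrm{cw}(B))$; $e_i^\star$ moves all balls of row $i+1$ unmatched above to row $i$; operators compose right to left, $e^\star_{[a,b]}=e^\star_a\cdots e^\star_b$, $\rho_N(B)=e^\star_{[1,L-1]}\cdots e^\star_{[1,1]}(B)$ for $B$ with $L$ rows. For a word $w=w_1\cdots w_k$ with letters in $[n]$, $\rho(w)=\rho_N((\{w_1\},\{w_2\},\dots,\{w_k\}))$. -}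

module Defs where

open import Data.Nat using (ℕ; zero; suc; _+_; _∸_; _≤_; _<_; _≥_; _≤ᵇ_; _≡ᵇ_)
open import Data.Bool using (Bool; true; false; if_then_else_; _∧_)
open import Data.Maybe using (Maybe; just; nothing; fromMaybe)
open import Data.Product using (_×_; _,_; proj₁; proj₂)
open import Data.Bool.ListAction using (any)
open import Data.List using (List; []; _∷_; [_]; _++_; map; concat; concatMap; length;
                             reverse; foldl; foldr; filter; upTo; downFrom)
open import Data.List.Relation.Unary.All using (All)
open import Data.List.Relation.Unary.Linked using (Linked)
open import Relation.Binary.PropositionalEquality using (_≡_)

-- Conventions
--  * A partition λ is a list λ₁ ≥ λ₂ ≥ … of positive naturals; ℓ(λ) = length λ.
--  * Rows of a multiline queue / ball configuration B = (B₁,…,B_L) are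
--    lists of column numbers (subsets of [n] as strictly increasing lists);
--    index 1 is the bottom row.
--  * A tableau is stored as the list of its columns, left to right, each
--    column listed from bottom to top (French notation).

Rows : Set
Rows = List (List ℕ)

IsPartition : List ℕ → Set
IsPartition la = Linked _≥_ la × All (λ x → 0 < x) la

λ₁ : List ℕ → ℕ
λ₁ [] = 0
λ₁ (x ∷ _) = x

conj : List ℕ → List ℕ
conj la = map (λ j → length (filter (λ x → j Data.Nat.≤? x) la)) (map suc (upTo (λ₁ la)))

at : {A : Set} → List A → ℕ → Maybe A
at [] _ = nothing
at (x ∷ xs) zero = just x
at (x ∷ xs) (suc i) = at xs i

InRange : ℕ → ℕ → Set
InRange n x = 1 ≤ x × x ≤ n

RowWeak : List ℕ → List ℕ → Set
RowWeak c c' = ∀ (i x y : ℕ) → at c i ≡ just x → at c' i ≡ just y → x ≤ y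

SSYT : List ℕ → ℕ → Rows → Set
SSYT la n T =
  map length T ≡ conj la ×
  All (All (InRange n)) T ×
  All (Linked _<_) T ×
  Linked RowWeak T

crw : Rows → List ℕ
crw T = concatMap reverse T

revcrw : Rows → List ℕ
revcrw T = reverse (crw T)

insCol : ℕ → List ℕ → Maybe ℕ × List ℕ
insCol x [] = nothing , [ x ]
insCol x (y ∷ ys) with x ≤ᵇ y
... | true = just y , x ∷ ys
... | false = proj₁ (insCol x ys) , y ∷ proj₂ (insCol x ys)

colInsert : ℕ → Rows → Rows
colInsert x [] = [ [ x ] ] 
colInsert x (c ∷ cs) with insCol x c
... | nothing , c' = c' ∷ cs
... | just y , c' = c' ∷ colInsert y cs

Icol : List ℕ → Rows
Icol w = foldl (λ T x → colInsert x T) [] w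

rw : Rows → List ℕ
rw M = concat M

firstFreeFrom : ℕ → List (ℕ × Maybe ℕ) → Maybe ℕ
firstFreeFrom j [] = nothing
firstFreeFrom j ((c , just _) ∷ xs) = firstFreeFrom j xs
firstFreeFrom j ((c , nothing) ∷ xs) = if j ≤ᵇ c then just c else firstFreeFrom j xs

setLabel : ℕ → ℕ → List (ℕ × Maybe ℕ) → List (ℕ × Maybe ℕ)
setLabel c ℓ = map (λ p → if proj₁ p ≡ᵇ c then (proj₁ p , just ℓ) else p)

-- pair one ball (column j, label ℓ) of row r with the lower row;
-- state = (lower row with partial labels, accumulated maj)
pairBall : ℕ → List (ℕ × Maybe ℕ) × ℕ → ℕ × ℕ → List (ℕ × Maybe ℕ) × ℕ
pairBall r (low , m) (j , ℓ) with firstFreeFrom j low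
... | just c = setLabel c ℓ low , m
... | nothing with firstFreeFrom 0 low
...   | just c = setLabel c ℓ low , m + (ℓ + 1 ∸ r)   -- wraps: contributes ℓ - r + 1
...   | nothing = low , m

-- upper: labelled balls (column, label) of row r (labels in [r, L]),
-- lower: columns of row r-1.  Returns labelled row r-1 and maj contribution.
pairRow : ℕ → ℕ → List (ℕ × ℕ) → List ℕ → List (ℕ × ℕ) × ℕ
pairRow r L upper lower =
  let order = concatMap (λ ℓ → filter (λ b → ℓ Data.Nat.≟ proj₂ b) upper)
                        (map (λ k → k + r) (downFrom (L + 1 ∸ r)))
      res   = foldl (pairBall r) (map (λ c → c , nothing) lower , 0) order
  in map (λ p → proj₁ p , fromMaybe (r ∸ 1) (proj₂ p)) (proj₁ res) , proj₂ res

majGo : ℕ → ℕ → List (ℕ × ℕ) → Rows → ℕ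
majGo L r upper [] = 0
majGo L r upper (B ∷ Bs) =
  proj₂ (pairRow r L upper B) + majGo L (r ∸ 1) (proj₁ (pairRow r L upper B)) Bs

maj : Rows → ℕ
maj M with reverse M
... | [] = 0
... | B ∷ Bs = majGo (length M) (length M) (map (λ c → c , length M) B) Bs

MLQ0 : List ℕ → ℕ → Rows → Set
MLQ0 la n M =
  map length M ≡ conj la ×
  All (All (InRange n)) M ×
  All (Linked _<_) M ×
  maj M ≡ 0

memb : ℕ → List ℕ → Bool
memb j B = any (λ x → x ≡ᵇ j) B

maxCol : Rows → ℕ
maxCol B = foldr Data.Nat._⊔_ 0 (concat B)

cwPos : Rows → List (ℕ × ℕ)
cwPos B = concatMap (λ j → concatMap (λ r → if memb j (fromMaybe [] (at B (r ∸ 1)))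
                                              then [ (r , j) ] else [])
                                      (map suc (downFrom (length B))))
                    (map suc (upTo (maxCol B)))

cw : Rows → List ℕ
cw B = map proj₁ (cwPos B)

-- Par_i: true = "(" (letter i+1), false = ")" (letter i), with the column
parens : ℕ → List (ℕ × ℕ) → List (Bool × ℕ)
parens i [] = []
parens i ((r , j) ∷ w) =
  if r ≡ᵇ suc i then (true , j) ∷ parens i w
  else if r ≡ᵇ i then (false , j) ∷ parens i w
  else parens i w

matchOnce : List (Bool × ℕ) → List (Bool × ℕ)
matchOnce [] = []
matchOnce ((true , a) ∷ (false , b) ∷ xs) = xs
matchOnce (x ∷ xs) = x ∷ matchOnce xs

iterate : ℕ → (List (Bool × ℕ) → List (Bool × ℕ)) → List (Bool × ℕ) → List (Bool × ℕ)
iterate zero f xs = xs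
iterate (suc k) f xs = iterate k f (f xs)

-- unmatched parentheses left after iterative matching (length w rounds suffice)
unmatchedPar : List (Bool × ℕ) → List (Bool × ℕ)
unmatchedPar p = iterate (length p) matchOnce p

unmatchedAbove : ℕ → Rows → List ℕ
unmatchedAbove i B = map proj₂ (filter (λ t → Data.Bool._≟_ (proj₁ t) true)
                                       (unmatchedPar (parens i (cwPos B))))

insertSorted : ℕ → List ℕ → List ℕ
insertSorted x [] = [ x ]
insertSorted x (y ∷ ys) with x Data.Nat.<ᵇ y | x ≡ᵇ y
... | true | _ = x ∷ y ∷ ys
... | false | true = y ∷ ys
... | false | false = y ∷ insertSorted x ys

-- modify row number k (1-based)
modifyRow : ℕ → (List ℕ → List ℕ) → Rows → Rows
modifyRow k f [] = []
modifyRow zero f B = B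
modifyRow (suc zero) f (b ∷ B) = f b ∷ B
modifyRow (suc (suc k)) f (b ∷ B) = b ∷ modifyRow (suc k) f B

estar : ℕ → Rows → Rows
estar i B =
  let U = unmatchedAbove i B in
  modifyRow i (λ b → foldr insertSorted b U)
    (modifyRow (suc i) (filter (λ x → Data.Bool._≟_ (memb x U) false)) B)

eInt : ℕ → Rows → Rows
eInt zero B = B
eInt (suc k) B = eInt k (estar (suc k) B)

ρN : Rows → Rows
ρN B = foldl (λ C k → eInt k C) B (map suc (upTo (length B ∸ 1)))

dropEmpty : Rows → Rows
dropEmpty ([] ∷ xs) = dropEmpty xs
dropEmpty xs = xs

stripTrailing : Rows → Rows
stripTrailing B = reverse (dropEmpty (reverse B))

-- ρ(w) = ρ_N(({w₁},…,{w_k})), identified with a multiline queue after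
-- deleting trailing empty rows
ρ : List ℕ → Rows
ρ w = stripTrailing (ρN (map [_] w))

mlq : Rows → Rows
mlq T = ρ (revcrw T)

tab : Rows → Rows
tab M = Icol (rw M)

{-# OPTIONS --safe #-}

-- For word letters x < y ≤ z call xzy, zxy and for x ≤ y < z call yzx, yxz elementary Knuth equivalent.
-- Column insertion Icol is invariant under the equivalence ≈ these generate, and w ≈ revcrw (Icol w).
-- The collapsing operator e⋆ moves the unmatched balls B∖B′ of a row B to the row A below, and the words
-- A·B and A′·B′ are equivalent; hence rw (ρ w) ≈ w. Counting balls weakly right of each column shows that
-- ρ w satisfies the Hall condition "every row r+1 can be paired with row r without wrapping", which is
-- equivalent to maj = 0. So tab ∘ mlq is the identity, because a tableau is the insertion tableau of its
-- own reading word. Conversely mlq (tab M) and M are nonwrapping queues with equivalent row words, and they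
-- agree because the reverse complement of such a queue is a tableau whose reading word is determined
-- up to equivalence. Shapes are kept since inserting a nonwrapping queue into its bottom row, read as
-- a column, bumps a nonwrapping queue with the remaining row lengths.
module Submission where

open import Defs
open import Data.Bool using (Bool; true; false; if_then_else_; T; _∨_; _≟_)
open import Data.List hiding (iterate)
open import Data.List.Properties
open import Data.List.Relation.Binary.Permutation.Propositional as Perm using (_↭_; ↭-refl; ↭-sym; ↭-trans; prep; swap)
open import Data.List.Relation.Binary.Permutation.Propositional.Properties
  using (All-resp-↭; filter-↭; ↭-reverse; ↭-length; shift; map⁺; ++⁺ˡ; ++-comm)
open import Data.List.Relation.Binary.Prefix.Heterogeneous using (Prefix; []; _∷_)
open import Data.List.Relation.Unary.All as All using (All; []; _∷_)
import Data.List.Relation.Unary.All.Properties as All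
open import Data.List.Relation.Unary.AllPairs as AllPairs using (AllPairs; []; _∷_)
open import Data.List.Relation.Unary.Linked as Linked using (Linked; []; [-]; _∷_)
import Data.List.Relation.Unary.Linked.Properties as Linked
open import Data.Maybe as Maybe using (Maybe; just; nothing)
import Data.Maybe.Relation.Unary.All as Maybe
open import Data.Nat hiding (_≟_)
import Data.Nat as ℕ
open import Data.Nat.Properties hiding (_≟_)
open import Data.Nat.Solver using (module +-*-Solver)
open import Data.Product using (_×_; _,_; proj₁; proj₂; ∃-syntax)
open import Data.Sum using (_⊎_; inj₁; inj₂; map₂)
open import Function using (_∘_; flip)
open import Relation.Binary.PropositionalEquality hiding ([_])
open import Relation.Nullary using (Dec; yes; no; contradiction)

open +-*-Solver using (solve; _:+_; _:=_)
open ≤-Reasoning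

-- The identity `tab ∘ mlq` only makes `tab` surjective; the other composite needs that a Knuth
-- class contains at most one nonwrapping queue without empty rows. The row word of a queue is in
-- general not the reading word of a tableau, so `Icol` does not recover the queue from it; this is
-- what forces the rotation. The obstacle in collapsing is that configurations in the middle of a
-- sweep need not be nonwrapping. The row in transit is therefore split into a part that fits
-- between its neighbours and a surplus, and only the numbers of surplus entries at or beyond each
-- threshold are followed. Such numbers, unlike an explicit matching, are insensitive to order, so
-- the order in which labelled balls are paired has no influence on whether maj vanishes.

-- Knuth equivalence of words

Inc : List ℕ → Set
Inc = AllPairs _<_

infix 4 _≈_
data _≈_ : List ℕ → List ℕ → Set where
  k₁    : ∀ {x y z} → x < y → y ≤ z → ∀ s → x ∷ z ∷ y ∷ s ≈ z ∷ x ∷ y ∷ s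
  k₂    : ∀ {x y z} → x ≤ y → y < z → ∀ s → y ∷ z ∷ x ∷ s ≈ y ∷ x ∷ z ∷ s
  cons  : ∀ x {u v} → u ≈ v → x ∷ u ≈ x ∷ v
  ≈refl : ∀ {u} → u ≈ u
  ≈sym  : ∀ {u v} → u ≈ v → v ≈ u
  ≈trans : ∀ {u v w} → u ≈ v → v ≈ w → u ≈ w

≡⇒≈ : ∀ {u v} → u ≡ v → u ≈ v
≡⇒≈ refl = ≈refl

≈-++ˡ : ∀ p {u v} → u ≈ v → p ++ u ≈ p ++ v
≈-++ˡ []      e = e
≈-++ˡ (x ∷ p) e = cons x (≈-++ˡ p e)

≈-++ʳ : ∀ {u v} s → u ≈ v → u ++ s ≈ v ++ s
≈-++ʳ s (k₁ p q t)   = k₁ p q (t ++ s)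
≈-++ʳ s (k₂ p q t)   = k₂ p q (t ++ s)
≈-++ʳ s (cons x e)   = cons x (≈-++ʳ s e)
≈-++ʳ s ≈refl        = ≈refl
≈-++ʳ s (≈sym e)     = ≈sym (≈-++ʳ s e)
≈-++ʳ s (≈trans e f) = ≈trans (≈-++ʳ s e) (≈-++ʳ s f)

≈⇒↭ : ∀ {u v} → u ≈ v → u ↭ v
≈⇒↭ (k₁ {x} {y} {z} _ _ s) = swap x z ↭-refl
≈⇒↭ (k₂ {x} {y} {z} _ _ s) = prep y (swap z x ↭-refl)
≈⇒↭ (cons x e)   = prep x (≈⇒↭ e)
≈⇒↭ ≈refl        = ↭-refl
≈⇒↭ (≈sym e)     = ↭-sym (≈⇒↭ e)
≈⇒↭ (≈trans e f) = ↭-trans (≈⇒↭ e) (≈⇒↭ f)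

-- Column insertion of letters and words

-- Ins x c o c′: inserting x into the column c leaves c′ and bumps o, a list with at most one entry.
data Ins (x : ℕ) : List ℕ → List ℕ → List ℕ → Set where
  top  : Ins x [] [] [ x ]
  bump : ∀ {h t} → x ≤ h → Ins x (h ∷ t) [ h ] (x ∷ t)
  pass : ∀ {h t o t′} → h < x → Ins x t o t′ → Ins x (h ∷ t) o (h ∷ t′)

infixl 5 _⇐_
_⇐_ : Rows → List ℕ → Rows
_⇐_ = foldl (λ T x → colInsert x T)

insCol-Ins : ∀ x c → Ins x c (fromMaybe (proj₁ (insCol x c))) (proj₂ (insCol x c))
insCol-Ins x [] = top
insCol-Ins x (h ∷ t) with x ≤ᵇ h in eq
... | true  = bump (≤ᵇ⇒≤ x h (subst T (sym eq) _))
... | false = pass (≰⇒> (λ p → subst T eq (≤⇒≤ᵇ p))) (insCol-Ins x t)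

Ins-det : ∀ {x c o c′ p d} → Ins x c o c′ → Ins x c p d → o ≡ p × c′ ≡ d
Ins-det top top = refl , refl
Ins-det (bump _) (bump _) = refl , refl
Ins-det (bump p) (pass q _) = contradiction p (<⇒≱ q)
Ins-det (pass q _) (bump p) = contradiction p (<⇒≱ q)
Ins-det (pass _ i) (pass _ j) with refl , refl ← Ins-det i j = refl , refl

Ins-colInsert : ∀ {x c o c′} cs → Ins x c o c′ → colInsert x (c ∷ cs) ≡ c′ ∷ (cs ⇐ o)
Ins-colInsert {x} {c} cs i with insCol x c | insCol-Ins x c
... | nothing , _ | j with refl , refl ← Ins-det i j = refl
... | just y  , _ | j with refl , refl ← Ins-det i j = refl

Ins-All : ∀ {P : ℕ → Set} {x c o c′} → Ins x c o c′ → P x → All P c → All P c′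
Ins-All top        px []       = px ∷ []
Ins-All (bump _)   px (_ ∷ pt) = px ∷ pt
Ins-All (pass _ i) px (ph ∷ pt) = ph ∷ Ins-All i px pt

Ins-out : ∀ {P : ℕ → Set} {x c o c′} → Ins x c o c′ → All P c → All P o
Ins-out top        []        = []
Ins-out (bump _)   (ph ∷ _)  = ph ∷ []
Ins-out (pass _ i) (_ ∷ pt)  = Ins-out i pt

Ins-≤out : ∀ {x c o c′} → Ins x c o c′ → All (x ≤_) o
Ins-≤out top        = []
Ins-≤out (bump p)   = p ∷ []
Ins-≤out (pass _ i) = Ins-≤out i

Ins-Inc : ∀ {x c o c′} → Ins x c o c′ → Inc c → Inc c′
Ins-Inc top        []        = [] ∷ []
Ins-Inc (bump p)   (ht ∷ t)  = All.map (≤-<-trans p) ht ∷ t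
Ins-Inc (pass q i) (ht ∷ t)  = Ins-All i q ht ∷ Ins-Inc i t

colInsert-Inc : ∀ x T → All Inc T → All Inc (colInsert x T)
colInsert-Inc x [] [] = ([] ∷ []) ∷ []
colInsert-Inc x (c ∷ cs) (ic ∷ ics) with insCol x c | insCol-Ins x c
... | nothing , c′ | i = Ins-Inc i ic ∷ ics
... | just y  , c′ | i = Ins-Inc i ic ∷ colInsert-Inc y cs ics

⇐-Inc : ∀ w T → All Inc T → All Inc (T ⇐ w)
⇐-Inc []      T iT = iT
⇐-Inc (x ∷ w) T iT = ⇐-Inc w (colInsert x T) (colInsert-Inc x T iT)

data InsW : List ℕ → List ℕ → List ℕ → List ℕ → Set where
  []  : ∀ {c} → InsW [] c [] c
  _∷_ : ∀ {x w c o c′ o′ c″} → Ins x c o c′ → InsW w c′ o′ c″ → InsW (x ∷ w) c (o ++ o′) c″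

⇐-++ : ∀ T u v → T ⇐ (u ++ v) ≡ (T ⇐ u) ⇐ v
⇐-++ T u v = foldl-++ _ T u v

-- Insertion never looks back to the left, so the whole word may pass through the first column
-- before any bumped letter enters the others.
InsW-⇐ : ∀ {w c o c′} cs → InsW w c o c′ → (c ∷ cs) ⇐ w ≡ c′ ∷ (cs ⇐ o)
InsW-⇐ cs [] = refl
InsW-⇐ {x ∷ w} {c′ = c″} cs (_∷_ {o = o} {o′ = o′} i is) =
  trans (cong (_⇐ w) (Ins-colInsert cs i))
        (trans (InsW-⇐ (cs ⇐ o) is) (cong (c″ ∷_) (sym (⇐-++ cs o o′))))

-- Invariance of insertion under Knuth equivalence

-- Passing a Knuth pair through a column bumps a Knuth pair or equal words (InsW-Knuth below), which
-- allows induction on the columns of a tableau.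
data Knuth : List ℕ → List ℕ → Set where
  K₁ : ∀ {x y z} → x < y → y ≤ z → Knuth (x ∷ z ∷ y ∷ []) (z ∷ x ∷ y ∷ [])
  K₂ : ∀ {x y z} → x ≤ y → y < z → Knuth (y ∷ z ∷ x ∷ []) (y ∷ x ∷ z ∷ [])

Result : List ℕ → List ℕ → List ℕ → List ℕ → Set
Result v c o c′ = ∃[ o′ ] InsW v c o′ c′ × (o ≡ o′ ⊎ Knuth o o′)

InsW-pass : ∀ {h w c o c′} → All (h <_) w → InsW w c o c′ → InsW w (h ∷ c) o (h ∷ c′)
InsW-pass []       []       = []
InsW-pass (p ∷ ps) (i ∷ is) = pass p i ∷ InsW-pass ps is

-- Once `z` sits in the column, the smallest entry that is at least `y` exists and is at most `z`.
bump-after : ∀ {y z t o t′ o′ t″} → y ≤ z → Ins z t o t′ → Ins y t′ o′ t″ →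
             ∃[ a ] o′ ≡ [ a ] × y ≤ a × a ≤ z
bump-after yz top (bump _) = _ , refl , yz , ≤-refl
bump-after yz top (pass z<y _) = contradiction yz (<⇒≱ z<y)
bump-after yz (bump _) (bump _) = _ , refl , yz , ≤-refl
bump-after yz (bump _) (pass z<y _) = contradiction yz (<⇒≱ z<y)
bump-after yz (pass h<z _) (bump y≤h) = _ , refl , y≤h , <⇒≤ h<z
bump-after yz (pass _ i) (pass _ j) = bump-after yz i j

Ins-out-view : ∀ {x c o c′} → Ins x c o c′ → o ≡ [] ⊎ ∃[ a ] o ≡ [ a ]
Ins-out-view top        = inj₁ refl
Ins-out-view (bump _)   = inj₂ (_ , refl)
Ins-out-view (pass _ i) = Ins-out-view i

-- The letter `z` passes `y`, which stands where `a` stood, so whatever `z` bumps comes from above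
-- that place.
bump-before : ∀ {y z t o t′ o′ t″} → Inc t → y < z → Ins y t o t′ → Ins z t′ o′ t″ →
              o′ ≡ [] ⊎ (∃[ a ] ∃[ b ] o ≡ [ a ] × o′ ≡ [ b ] × y ≤ a × a < b)
bump-before _ y<z top (bump z≤y) = contradiction z≤y (<⇒≱ y<z)
bump-before _ y<z top (pass _ top) = inj₁ refl
bump-before _ y<z (bump _) (bump z≤y) = contradiction z≤y (<⇒≱ y<z)
bump-before (ht ∷ _) y<z (bump y≤h) (pass _ j) with Ins-out-view j
... | inj₁ refl = inj₁ refl
... | inj₂ (_ , refl) with h<b ∷ [] ← Ins-out j ht = inj₂ (_ , _ , refl , refl , y≤h , h<b)
bump-before _ y<z (pass h<y _) (bump z≤h) = contradiction z≤h (<⇒≱ (<-trans h<y y<z))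
bump-before (_ ∷ it) y<z (pass _ i) (pass _ j) = bump-before it y<z i j

-- Induction on the column: a bottom entry passed by all three letters can be removed, otherwise the
-- bumps are compared directly. A pair of the first kind can bump one of the second (when `z ≤ h`),
-- so `Result` leaves the kind open.
InsW-Knuth : ∀ {u v c o c′} → Inc c → Knuth u v → InsW u c o c′ → Result v c o c′
InsW-Knuth _ (K₁ x<y y≤z) (top ∷ bump z≤x ∷ _) = contradiction z≤x (<⇒≱ (<-≤-trans x<y y≤z))
InsW-Knuth _ (K₁ x<y y≤z) (top ∷ pass _ top ∷ bump y≤x ∷ []) = contradiction y≤x (<⇒≱ x<y)
InsW-Knuth _ (K₁ x<y y≤z) (top ∷ pass x<z top ∷ pass _ (bump _) ∷ []) =
  _ , top ∷ bump (<⇒≤ x<z) ∷ pass x<y top ∷ [] , inj₁ refl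
InsW-Knuth _ (K₁ x<y y≤z) (top ∷ pass x<z top ∷ pass _ (pass z<y _) ∷ []) = contradiction y≤z (<⇒≱ z<y)
InsW-Knuth _ (K₁ x<y y≤z) (bump x≤h ∷ bump z≤x ∷ _) = contradiction z≤x (<⇒≱ (<-≤-trans x<y y≤z))
InsW-Knuth _ (K₁ x<y y≤z) (bump x≤h ∷ pass _ _ ∷ bump y≤x ∷ []) = contradiction y≤x (<⇒≱ x<y)
-- In the other word `z` meets `h` itself, before `x` has replaced it, and either bumps or passes
-- it.
InsW-Knuth {c = h ∷ t} (ht ∷ _) (K₁ {x} {y} {z} x<y y≤z) (bump x≤h ∷ pass x<z j ∷ pass _ k ∷ []) with z ≤? h
... | no z≰h = result (Ins-out-view j)
  where
  h<z = ≰⇒> z≰h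
  result : _ → Result (z ∷ x ∷ y ∷ []) (h ∷ t) _ _
  result view with bump-after y≤z j k | Ins-out k (Ins-All j h<z ht)
  result (inj₁ refl) | _ | _ = _ , pass h<z j ∷ bump x≤h ∷ pass x<y k ∷ [] , inj₁ refl
  result (inj₂ (_ , refl)) | a , refl , y≤a , a≤z | h<a ∷ [] with z≤b ∷ [] ← Ins-≤out j =
    _ , pass h<z j ∷ bump x≤h ∷ pass x<y k ∷ [] , inj₂ (K₁ h<a (≤-trans a≤z z≤b))
... | yes z≤h = result j k ht
  where
  result : ∀ {t t′ t″ o o′} → Ins z t o t′ → Ins y t′ o′ t″ → All (h <_) t →
           Result (z ∷ x ∷ y ∷ []) (h ∷ t) (h ∷ o ++ o′ ++ []) (x ∷ t″)
  result top (bump _) _ = _ , bump z≤h ∷ bump (<⇒≤ x<z) ∷ pass x<y top ∷ [] , inj₁ refl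
  result top (pass z<y _) _ = contradiction y≤z (<⇒≱ z<y)
  result (bump z≤a) (bump _) (h<a ∷ _) =
    _ , bump z≤h ∷ bump (<⇒≤ x<z) ∷ pass x<y (bump (≤-trans y≤z z≤a)) ∷ [] , inj₂ (K₂ z≤h h<a)
  result (bump _) (pass z<y _) _ = contradiction y≤z (<⇒≱ z<y)
  result (pass a<z _) _ (h<a ∷ _) = contradiction z≤h (<⇒≱ (<-trans h<a a<z))
InsW-Knuth (_ ∷ it) (K₁ x<y y≤z) (pass h<x i ∷ is) = below (InsW-Knuth it (K₁ x<y y≤z)) i is
  where
  h<y = <-trans h<x x<y
  h<z = <-≤-trans h<y y≤z
  below : (∀ {o c′} → InsW _ _ o c′ → Result _ _ o c′) → ∀ {o o′ t′ c′} → Ins _ _ o t′ →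
          InsW _ (_ ∷ t′) o′ c′ → Result _ _ (o ++ o′) c′
  below ih i (bump z≤h ∷ _) = contradiction z≤h (<⇒≱ h<z)
  below ih i (pass _ j ∷ bump y≤h ∷ []) = contradiction y≤h (<⇒≱ h<y)
  below ih i (pass _ j ∷ pass _ k ∷ []) with _ , is , e ← ih (i ∷ j ∷ k ∷ []) =
    _ , InsW-pass (h<z ∷ h<x ∷ h<y ∷ []) is , e
InsW-Knuth _ (K₂ x≤y y<z) (top ∷ bump z≤y ∷ _) = contradiction z≤y (<⇒≱ y<z)
InsW-Knuth _ (K₂ x≤y y<z) (top ∷ pass _ top ∷ pass y<x _ ∷ []) = contradiction x≤y (<⇒≱ y<x)
InsW-Knuth _ (K₂ x≤y y<z) (top ∷ pass _ top ∷ bump _ ∷ []) =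
  _ , top ∷ bump x≤y ∷ pass (≤-<-trans x≤y y<z) top ∷ [] , inj₁ refl
InsW-Knuth _ (K₂ x≤y y<z) (bump _ ∷ bump z≤y ∷ _) = contradiction z≤y (<⇒≱ y<z)
InsW-Knuth _ (K₂ x≤y y<z) (bump _ ∷ pass _ _ ∷ pass y<x _ ∷ []) = contradiction x≤y (<⇒≱ y<x)
InsW-Knuth (ht ∷ _) (K₂ x≤y y<z) (bump y≤h ∷ pass _ j ∷ bump _ ∷ []) with Ins-out-view j | Ins-out j ht
... | inj₁ refl | _ = _ , bump y≤h ∷ bump x≤y ∷ pass (≤-<-trans x≤y y<z) j ∷ [] , inj₁ refl
... | inj₂ (_ , refl) | h<b ∷ [] =
  _ , bump y≤h ∷ bump x≤y ∷ pass (≤-<-trans x≤y y<z) j ∷ [] , inj₂ (K₂ y≤h h<b)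
InsW-Knuth _ (K₂ x≤y y<z) (pass h<y _ ∷ bump z≤h ∷ _) = contradiction z≤h (<⇒≱ (<-trans h<y y<z))
InsW-Knuth (_ ∷ it) (K₂ x≤y y<z) (pass h<y i ∷ pass _ j ∷ bump x≤h ∷ []) with bump-before it y<z i j
... | inj₁ refl = _ , pass h<y i ∷ bump x≤h ∷ pass (≤-<-trans x≤y y<z) j ∷ [] , inj₁ refl
... | inj₂ (_ , _ , refl , refl , y≤a , a<b) =
  _ , pass h<y i ∷ bump x≤h ∷ pass (≤-<-trans x≤y y<z) j ∷ [] , inj₂ (K₂ (<⇒≤ (<-≤-trans h<y y≤a)) a<b)
InsW-Knuth (_ ∷ it) (K₂ x≤y y<z) (pass h<y i ∷ pass h<z j ∷ pass h<x k ∷ [])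
  with _ , is , e ← InsW-Knuth it (K₂ x≤y y<z) (i ∷ j ∷ k ∷ []) =
  _ , InsW-pass (h<y ∷ h<x ∷ h<z ∷ []) is , e

InsW-total : ∀ w c → ∃[ o ] ∃[ c′ ] InsW w c o c′
InsW-total []      c = _ , _ , []
InsW-total (x ∷ w) c with _ , _ , is ← InsW-total w (proj₂ (insCol x c)) = _ , _ , insCol-Ins x c ∷ is

-- Through the empty column both words bump the same word, so no induction hypothesis is needed there.
⇐-Knuth : ∀ T {u v} → All Inc T → Knuth u v → T ⇐ u ≡ T ⇐ v
⇐-Knuth (c ∷ cs) {u} {v} (ic ∷ ics) κ
  with o , c′ , is ← InsW-total u c
  with o′ , js , e ← InsW-Knuth ic κ is =
  trans (InsW-⇐ cs is) (trans (cong (c′ ∷_) (rest e)) (sym (InsW-⇐ cs js)))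
  where
  rest : o ≡ o′ ⊎ Knuth o o′ → cs ⇐ o ≡ cs ⇐ o′
  rest (inj₁ refl) = refl
  rest (inj₂ κ′)   = ⇐-Knuth cs ics κ′
⇐-Knuth [] _ (K₁ {x} {y} {z} x<y y≤z) =
  trans (InsW-⇐ {x ∷ z ∷ y ∷ []} [] (top ∷ pass x<z top ∷ pass x<y (bump y≤z) ∷ []))
        (sym (InsW-⇐ {z ∷ x ∷ y ∷ []} [] (top ∷ bump (<⇒≤ x<z) ∷ pass x<y top ∷ [])))
  where x<z = <-≤-trans x<y y≤z
⇐-Knuth [] _ (K₂ {x} {y} {z} x≤y y<z) =
  trans (InsW-⇐ {y ∷ z ∷ x ∷ []} [] (top ∷ pass y<z top ∷ bump x≤y ∷ []))
        (sym (InsW-⇐ {y ∷ x ∷ z ∷ []} [] (top ∷ bump x≤y ∷ pass (≤-<-trans x≤y y<z) top ∷ [])))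

⇐-≈ : ∀ {u v} T → All Inc T → u ≈ v → T ⇐ u ≡ T ⇐ v
⇐-≈ T iT (k₁ p q s)   = cong (_⇐ s) (⇐-Knuth T iT (K₁ p q))
⇐-≈ T iT (k₂ p q s)   = cong (_⇐ s) (⇐-Knuth T iT (K₂ p q))
⇐-≈ T iT (cons x e)   = ⇐-≈ (colInsert x T) (colInsert-Inc x T iT) e
⇐-≈ T iT ≈refl        = refl
⇐-≈ T iT (≈sym e)     = sym (⇐-≈ T iT e)
⇐-≈ T iT (≈trans e f) = trans (⇐-≈ T iT e) (⇐-≈ T iT f)

Icol-≈ : ∀ {u v} → u ≈ v → Icol u ≡ Icol v
Icol-≈ = ⇐-≈ [] []

-- A word is equivalent to the reading word of its insertion tableau

-- The letter `x` travels left by `k₂` until it stands just after the entry it bumps; that entry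
-- then travels on to the front by `k₁`, the letter behind it serving as the middle value.
Ins-≈ : ∀ {x c o c′} → Inc c → Ins x c o c′ → c ++ [ x ] ≈ o ++ c′
Ins-≈ _ top = ≈refl
Ins-≈ {x} {h ∷ t} (ht ∷ it) (bump x≤h) = slide x≤h (ht ∷ it)
  where
  slide : ∀ {h t} → x ≤ h → Inc (h ∷ t) → h ∷ t ++ [ x ] ≈ h ∷ x ∷ t
  slide {t = []}    _   _ = ≈refl
  slide {h} {a ∷ t} x≤h ((h<a ∷ _) ∷ it) =
    ≈trans (cons h (slide (≤-trans x≤h (<⇒≤ h<a)) it)) (k₂ x≤h h<a t)
Ins-≈ {x} {h ∷ t} (ht ∷ it) (pass {o = o} {t′} h<x i) =
  ≈trans (cons h (Ins-≈ it i)) (move (Ins-out-view i) i (Ins-All i h<x ht))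
  where
  move : o ≡ [] ⊎ ∃[ a ] o ≡ [ a ] → Ins x t o t′ → All (h <_) t′ → h ∷ o ++ t′ ≈ o ++ h ∷ t′
  move (inj₁ refl) _ _ = ≈refl
  move (inj₂ (_ , refl)) (bump x≤a) (h<x ∷ _) = k₁ h<x x≤a _
  move (inj₂ (a , refl)) (pass {h = b} b<x j) (h<b ∷ _) with x≤a ∷ [] ← Ins-≤out j =
    k₁ h<b (<⇒≤ (<-≤-trans b<x x≤a)) _

revcrw-∷ : ∀ c cs → revcrw (c ∷ cs) ≡ revcrw cs ++ c
revcrw-∷ c cs = trans (reverse-++ (reverse c) (crw cs)) (cong (revcrw cs ++_) (reverse-involutive c))

colInsert-≈ : ∀ x T → All Inc T → revcrw T ++ [ x ] ≈ revcrw (colInsert x T)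
colInsert-≈ x [] _ = ≈refl
colInsert-≈ x (c ∷ cs) (ic ∷ ics) with insCol x c | insCol-Ins x c
... | nothing , c′ | i = begin≈
  where
  begin≈ : revcrw (c ∷ cs) ++ [ x ] ≈ revcrw (c′ ∷ cs)
  begin≈ rewrite revcrw-∷ c cs | revcrw-∷ c′ cs | ++-assoc (revcrw cs) c [ x ] = ≈-++ˡ (revcrw cs) (Ins-≈ ic i)
... | just y , c′ | i = begin≈
  where
  begin≈ : revcrw (c ∷ cs) ++ [ x ] ≈ revcrw (c′ ∷ colInsert y cs)
  begin≈ rewrite revcrw-∷ c cs | revcrw-∷ c′ (colInsert y cs) | ++-assoc (revcrw cs) c [ x ] =
    ≈trans (≈-++ˡ (revcrw cs) (Ins-≈ ic i))
           (≈trans (≡⇒≈ (sym (++-assoc (revcrw cs) [ y ] c′))) (≈-++ʳ c′ (colInsert-≈ y cs ics)))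

⇐-revcrw : ∀ w T → All Inc T → revcrw T ++ w ≈ revcrw (T ⇐ w)
⇐-revcrw []      T _  = ≡⇒≈ (++-identityʳ _)
⇐-revcrw (x ∷ w) T iT =
  ≈trans (≡⇒≈ (sym (++-assoc (revcrw T) [ x ] w)))
         (≈trans (≈-++ʳ w (colInsert-≈ x T iT)) (⇐-revcrw w (colInsert x T) (colInsert-Inc x T iT)))

≈-revcrw-Icol : ∀ w → w ≈ revcrw (Icol w)
≈-revcrw-Icol w = ⇐-revcrw w [] []

-- Two consecutive tableau columns: the first is at least as long, and rows weakly increase.
infix 4 _⊵_
_⊵_ : List ℕ → List ℕ → Set
c ⊵ d = Prefix _≥_ d c

NonEmpty : List ℕ → Set
NonEmpty c = 0 < length c

-- Tableaux are fixed by insertion of their reading word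

InsW-[] : ∀ {c} → Inc c → InsW c [] [] c
InsW-[] []        = []
InsW-[] (p ∷ ps) = top ∷ InsW-pass p (InsW-[] ps)

InsW-⊵ : ∀ {c d} → Inc c → c ⊵ d → InsW c d d c
InsW-⊵ ic []               = InsW-[] ic
InsW-⊵ (p ∷ ps) (x≤y ∷ q) = bump x≤y ∷ InsW-pass p (InsW-⊵ ps q)

-- Each letter of `c` bumps its neighbour in the first column of `T` and the excess goes on top, so
-- that column is displaced as a whole and in turn displaces the next one.
⇐-column : ∀ {c T} → All Inc (c ∷ T) → All NonEmpty (c ∷ T) → Linked _⊵_ (c ∷ T) → T ⇐ c ≡ c ∷ T
⇐-column {x ∷ c} {[]} (ic ∷ _) (_ ∷ []) _ = InsW-⇐ [] (InsW-[] ic)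
⇐-column {c} {d ∷ T} (ic ∷ iT) (_ ∷ nT) (q ∷ qs) =
  trans (InsW-⇐ T (InsW-⊵ ic q)) (cong (c ∷_) (⇐-column iT nT qs))

Icol-revcrw : ∀ T → All Inc T → All NonEmpty T → Linked _⊵_ T → Icol (revcrw T) ≡ T
Icol-revcrw []      _ _ _ = refl
Icol-revcrw (c ∷ T) i@(_ ∷ iT) n@(_ ∷ nT) l
  rewrite revcrw-∷ c T | ⇐-++ [] (revcrw T) c | Icol-revcrw T iT nT (Linked.tail l) = ⇐-column i n l

-- Insertion produces tableaux

⊵-Ins : ∀ {x c o c′ d} → Ins x c o c′ → c ⊵ d → c′ ⊵ d
⊵-Ins _          []      = []
⊵-Ins (bump p)   (q ∷ r) = ≤-trans p q ∷ r
⊵-Ins (pass _ i) (q ∷ r) = q ∷ ⊵-Ins i r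

-- The bumped `y` cannot climb: its right neighbour, if any, is at least `y`. It lands at its old
-- height or lower, where the entry of `c′` is at most `x`, hence at most `y`.
⊵-Ins-Ins : ∀ {x c y c′ d o d′} → Ins x c [ y ] c′ → c ⊵ d → Ins y d o d′ → c′ ⊵ d′
⊵-Ins-Ins (bump p)   []      top        = p ∷ []
⊵-Ins-Ins (bump p)   (q ∷ r) (bump _)   = p ∷ r
⊵-Ins-Ins (bump p)   (q ∷ r) (pass e _) = contradiction q (<⇒≱ e)
⊵-Ins-Ins (pass h i) []      top        with x≤y ∷ [] ← Ins-≤out i = <⇒≤ (<-≤-trans h x≤y) ∷ []
⊵-Ins-Ins (pass h i) (q ∷ r) (bump _)   with x≤y ∷ [] ← Ins-≤out i = <⇒≤ (<-≤-trans h x≤y) ∷ ⊵-Ins i r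
⊵-Ins-Ins (pass h i) (q ∷ r) (pass e j) = q ∷ ⊵-Ins-Ins i r j

colInsert-⊵ : ∀ {x c y c′} T → Ins x c [ y ] c′ → Linked _⊵_ (c ∷ T) → Linked _⊵_ (c′ ∷ colInsert y T)
colInsert-⊵ {y = y} []      i _       = ⊵-Ins-Ins i [] top ∷ [-]
colInsert-⊵ {y = y} (d ∷ T) i (q ∷ l) with insCol y d | insCol-Ins y d
... | nothing , d′ | j = ⊵-Ins-Ins i q j ∷ relink l
  where
  relink : Linked _⊵_ (d ∷ T) → Linked _⊵_ (d′ ∷ T)
  relink [-]      = [-]
  relink (r ∷ l′) = ⊵-Ins j r ∷ l′
... | just z , d′  | j = ⊵-Ins-Ins i q j ∷ colInsert-⊵ T j l

colInsert-tableau : ∀ x T → Linked _⊵_ T → Linked _⊵_ (colInsert x T)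
colInsert-tableau x [] _ = [-]
colInsert-tableau x (c ∷ T) l with insCol x c | insCol-Ins x c
... | just y , c′  | i = colInsert-⊵ T i l
... | nothing , c′ | i = relink l
  where
  relink : Linked _⊵_ (c ∷ T) → Linked _⊵_ (c′ ∷ T)
  relink [-]      = [-]
  relink (r ∷ l′) = ⊵-Ins i r ∷ l′

⇐-tableau : ∀ w T → Linked _⊵_ T → Linked _⊵_ (T ⇐ w)
⇐-tableau []      T l = l
⇐-tableau (x ∷ w) T l = ⇐-tableau w (colInsert x T) (colInsert-tableau x T l)

⊵⇒RowWeak : ∀ {c d} → c ⊵ d → RowWeak c d
⊵⇒RowWeak (p ∷ q) zero    _ _ refl refl = p
⊵⇒RowWeak (p ∷ q) (suc i) x y e f       = ⊵⇒RowWeak q i x y e f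

RowWeak⇒⊵ : ∀ c d → length d ≤ length c → RowWeak c d → c ⊵ d
RowWeak⇒⊵ c       []      _       r = []
RowWeak⇒⊵ (x ∷ c) (y ∷ d) (s≤s l) r =
  r 0 x y refl refl ∷ RowWeak⇒⊵ c d l (λ i → r (suc i))

-- Counting entries

cnt : ℕ → List ℕ → ℕ
cnt j xs = length (filter (j ≤?_) xs)

cnt-≤ : ∀ {j x} xs → j ≤ x → cnt j (x ∷ xs) ≡ suc (cnt j xs)
cnt-≤ {j} xs p = cong length (filter-accept (j ≤?_) p)

cnt-> : ∀ {j x} xs → x < j → cnt j (x ∷ xs) ≡ cnt j xs
cnt-> {j} xs p = cong length (filter-reject (j ≤?_) (<⇒≱ p))

cnt-all : ∀ {j xs} → All (j ≤_) xs → cnt j xs ≡ length xs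
cnt-all {j} ps = cong length (filter-all (j ≤?_) ps)

cnt-none : ∀ {j xs} → All (_< j) xs → cnt j xs ≡ 0
cnt-none {j} ps = cong length (filter-none (j ≤?_) (All.map <⇒≱ ps))

cnt-length : ∀ j xs → cnt j xs ≤ length xs
cnt-length j xs = length-filter (j ≤?_) xs

cnt-tail : ∀ j x xs → cnt j xs ≤ cnt j (x ∷ xs)
cnt-tail j x xs with ≤-<-connex j x
... | inj₁ j≤x rewrite cnt-≤ xs j≤x = n≤1+n _
... | inj₂ x<j rewrite cnt-> xs x<j = ≤-refl

cnt-anti : ∀ {i j} xs → i ≤ j → cnt j xs ≤ cnt i xs
cnt-anti [] _ = z≤n
cnt-anti {i} {j} (x ∷ xs) i≤j with ≤-<-connex j x
... | inj₁ j≤x rewrite cnt-≤ xs j≤x | cnt-≤ xs (≤-trans i≤j j≤x) = s≤s (cnt-anti xs i≤j)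
... | inj₂ x<j rewrite cnt-> xs x<j = ≤-trans (cnt-anti xs i≤j) (cnt-tail i x xs)

cnt-0 : ∀ xs → cnt 0 xs ≡ length xs
cnt-0 xs = cnt-all {0} (All.universal (λ _ → z≤n) xs)

cnt-↭ : ∀ j {xs ys} → xs ↭ ys → cnt j xs ≡ cnt j ys
cnt-↭ j p = ↭-length (filter-↭ (j ≤?_) p)

-- Nonwrapping queues and the merging of rows

-- Hall's condition: a ball in column `j` reaches without wrapping exactly the balls weakly right of
-- `j`, so only final segments need testing.
Dom : List ℕ → List ℕ → Set
Dom B A = ∀ j → cnt j B ≤ cnt j A

Dom-length : ∀ {A B} → Dom B A → length B ≤ length A
Dom-length {A} {B} d = subst₂ _≤_ (cnt-0 B) (cnt-0 A) (d 0)

NonWrapping : Rows → Set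
NonWrapping = Linked (λ A B → Dom B A)

-- Inserting an increasing word B into a column A all of whose bumps succeed:
-- Merge B A C O says that A becomes C and the bumped word is O.
data Merge : (B A C O : List ℕ) → Set where
  done : ∀ {A} → Merge [] A A []
  bump : ∀ {b y B A C O} → b ≤ y → Merge B A C O → Merge (b ∷ B) (y ∷ A) (b ∷ C) (y ∷ O)
  pass : ∀ {b y B A C O} → y < b → Merge (b ∷ B) A C O → Merge (b ∷ B) (y ∷ A) (y ∷ C) O

Merge-InsW : ∀ {B A C O} → Inc B → Merge B A C O → InsW B A O C
Merge-InsW _        done       = []
Merge-InsW (p ∷ iB) (bump q m) = bump q ∷ InsW-pass p (Merge-InsW iB m)
Merge-InsW i@(p ∷ _) (pass q m) = InsW-pass (q ∷ All.map (<-trans q) p) (Merge-InsW i m)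

Merge-C : ∀ {P : ℕ → Set} {B A C O} → Merge B A C O → All P B → All P A → All P C
Merge-C done       _          pA        = pA
Merge-C (bump _ m) (pb ∷ pB)  (_ ∷ pA)  = pb ∷ Merge-C m pB pA
Merge-C (pass _ m) pB         (py ∷ pA) = py ∷ Merge-C m pB pA

Merge-O : ∀ {P : ℕ → Set} {B A C O} → Merge B A C O → All P A → All P O
Merge-O done       _         = []
Merge-O (bump _ m) (py ∷ pA) = py ∷ Merge-O m pA
Merge-O (pass _ m) (_ ∷ pA)  = Merge-O m pA

Merge-IncC : ∀ {B A C O} → Merge B A C O → Inc B → Inc A → Inc C
Merge-IncC done       _          iA        = iA
Merge-IncC (bump p m) (q ∷ iB)   (r ∷ iA)  = Merge-C m q (All.map (≤-<-trans p) r) ∷ Merge-IncC m iB iA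
Merge-IncC (pass p m) iB@(q ∷ _) (r ∷ iA)  = Merge-C m (p ∷ All.map (<-trans p) q) r ∷ Merge-IncC m iB iA

Merge-IncO : ∀ {B A C O} → Merge B A C O → Inc A → Inc O
Merge-IncO done       _        = []
Merge-IncO (bump _ m) (r ∷ iA) = Merge-O m r ∷ Merge-IncO m iA
Merge-IncO (pass _ m) (_ ∷ iA) = Merge-IncO m iA

Merge-|C| : ∀ {B A C O} → Merge B A C O → length C ≡ length A
Merge-|C| done       = refl
Merge-|C| (bump _ m) = cong suc (Merge-|C| m)
Merge-|C| (pass _ m) = cong suc (Merge-|C| m)

Merge-|O| : ∀ {B A C O} → Merge B A C O → length O ≡ length B
Merge-|O| done       = refl
Merge-|O| (bump _ m) = cong suc (Merge-|O| m)
Merge-|O| (pass _ m) = Merge-|O| m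

Merge-↭ : ∀ {B A C O} → Merge B A C O → C ++ O ↭ A ++ B
Merge-↭ done = ↭-refl
Merge-↭ (bump {b} {y} {B} {A} {C} {O} _ m) =
  ↭-trans (prep b (↭-trans (shift y C O) (prep y (Merge-↭ m))))
          (↭-trans (swap b y ↭-refl) (prep y (↭-sym (shift b A B))))
Merge-↭ (pass {y = y} _ m) = prep y (Merge-↭ m)

Merge-B≤O : ∀ {B A C O} → Merge B A C O → ∀ j → cnt j B ≤ cnt j O
Merge-B≤O done j = z≤n
Merge-B≤O (bump {b} {y} {B} {O = O} b≤y m) j with ≤-<-connex j b
... | inj₁ j≤b rewrite cnt-≤ B j≤b | cnt-≤ O (≤-trans j≤b b≤y) = s≤s (Merge-B≤O m j)
... | inj₂ b<j rewrite cnt-> B b<j = ≤-trans (Merge-B≤O m j) (cnt-tail j y O)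
Merge-B≤O (pass _ m) j = Merge-B≤O m j

Merge-B≤C : ∀ {B A C O} → Merge B A C O → ∀ j → cnt j B ≤ cnt j C
Merge-B≤C done j = z≤n
Merge-B≤C (bump {b} {B = B} {C = C} _ m) j with ≤-<-connex j b
... | inj₁ j≤b rewrite cnt-≤ B j≤b | cnt-≤ C j≤b = s≤s (Merge-B≤C m j)
... | inj₂ b<j rewrite cnt-> B b<j | cnt-> C b<j = Merge-B≤C m j
Merge-B≤C (pass {y = y} {C = C} _ m) j = ≤-trans (Merge-B≤C m j) (cnt-tail j y C)

-- O is a sublist of A, so it has no more entries than A in [i , j).
Merge-O⊆A : ∀ {B A C O i j} → i ≤ j → Merge B A C O → cnt i O + cnt j A ≤ cnt i A + cnt j O
Merge-O⊆A {A = A} {i = i} i≤j done rewrite +-identityʳ (cnt i A) = cnt-anti A i≤j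
Merge-O⊆A {i = i} {j} i≤j (bump {y = y} {A = A} {O = O} _ m) with ≤-<-connex j y | ≤-<-connex i y
... | inj₁ j≤y | _ rewrite cnt-≤ A j≤y | cnt-≤ O j≤y | cnt-≤ A (≤-trans i≤j j≤y) | cnt-≤ O (≤-trans i≤j j≤y)
                         | +-suc (cnt i O) (cnt j A) | +-suc (cnt i A) (cnt j O) = s≤s (s≤s (Merge-O⊆A i≤j m))
... | inj₂ y<j | inj₁ i≤y rewrite cnt-> A y<j | cnt-> O y<j | cnt-≤ A i≤y | cnt-≤ O i≤y = s≤s (Merge-O⊆A i≤j m)
... | inj₂ y<j | inj₂ y<i rewrite cnt-> A y<j | cnt-> O y<j | cnt-> A y<i | cnt-> O y<i = Merge-O⊆A i≤j m
Merge-O⊆A {i = i} {j} i≤j (pass {y = y} {A = A} {O = O} _ m) with ≤-<-connex j y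
... | inj₁ j≤y rewrite cnt-≤ A j≤y | cnt-≤ A (≤-trans i≤j j≤y) | +-suc (cnt i O) (cnt j A) = s≤s (Merge-O⊆A i≤j m)
... | inj₂ y<j rewrite cnt-> A y<j = ≤-trans (Merge-O⊆A i≤j m) (+-monoˡ-≤ (cnt j O) (cnt-tail i y A))

-- The entries of O that are ≥ j come from the entries of B beyond some i ≤ j, of which
-- the entries of A in [i , j) absorb one each.
Merge-tight : ∀ {B A C O} → Inc B → Inc A → Merge B A C O → ∀ j →
              ∃[ i ] i ≤ j × cnt j O + cnt i A ≤ cnt i B + cnt j A
Merge-tight _ _ done j = j , ≤-refl , ≤-refl
Merge-tight {b ∷ B} {y ∷ A} {O = y ∷ O} (bB ∷ iB) (yA ∷ iA) m@(bump b≤y m′) j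
  with ≤-<-connex j b | ≤-<-connex j y
... | inj₁ j≤b | _ = j , ≤-refl , +-monoˡ-≤ (cnt j (y ∷ A)) (begin
      cnt j (y ∷ O)       ≤⟨ cnt-length j (y ∷ O) ⟩
      length (y ∷ O)      ≡⟨ Merge-|O| m ⟩
      length (b ∷ B)      ≡⟨ cnt-all (j≤b ∷ All.map (λ p → ≤-trans j≤b (<⇒≤ p)) bB) ⟨
      cnt j (b ∷ B)       ∎)
... | inj₂ b<j | inj₁ j≤y = b , <⇒≤ b<j , +-mono-≤ (begin
      cnt j (y ∷ O)       ≤⟨ cnt-length j (y ∷ O) ⟩
      length (y ∷ O)      ≡⟨ Merge-|O| m ⟩
      length (b ∷ B)      ≡⟨ cnt-all (≤-refl ∷ All.map <⇒≤ bB) ⟨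
      cnt b (b ∷ B)       ∎) (begin
      cnt b (y ∷ A)       ≤⟨ cnt-length b (y ∷ A) ⟩
      length (y ∷ A)      ≡⟨ cnt-all (j≤y ∷ All.map (λ p → ≤-trans j≤y (<⇒≤ p)) yA) ⟨
      cnt j (y ∷ A)       ∎)
... | inj₂ b<j | inj₂ y<j with i , i≤j , le ← Merge-tight iB iA m′ j
  rewrite cnt-> O y<j | cnt-> A y<j with ≤-<-connex i b | ≤-<-connex i y
...     | inj₁ i≤b | _ = i , i≤j , (begin
      cnt j O + cnt i (y ∷ A)       ≡⟨ cong (cnt j O +_) (cnt-≤ A (≤-trans i≤b b≤y)) ⟩
      cnt j O + suc (cnt i A)       ≡⟨ +-suc _ _ ⟩
      suc (cnt j O + cnt i A)       ≤⟨ s≤s le ⟩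
      suc (cnt i B) + cnt j A       ≡⟨ cong (_+ cnt j A) (cnt-≤ B i≤b) ⟨
      cnt i (b ∷ B) + cnt j A       ∎)
...     | inj₂ b<i | inj₂ y<i = i , i≤j , (begin
      cnt j O + cnt i (y ∷ A)       ≡⟨ cong (cnt j O +_) (cnt-> A y<i) ⟩
      cnt j O + cnt i A             ≤⟨ le ⟩
      cnt i B + cnt j A             ≤⟨ +-monoˡ-≤ (cnt j A) (cnt-tail i b B) ⟩
      cnt i (b ∷ B) + cnt j A       ∎)
-- The inductive threshold lies in `(b , y]`, where it counts `y` but not `b`. Lowered to `b` it
-- counts both, and gains nothing else in `A`.
...     | inj₂ b<i | inj₁ i≤y = b , <⇒≤ b<j , (begin
      cnt j O + cnt b (y ∷ A)       ≡⟨ cong (cnt j O +_) (cnt-≤ A b≤y) ⟩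
      cnt j O + suc (cnt b A)       ≡⟨ +-suc _ _ ⟩
      suc (cnt j O + cnt b A)       ≤⟨ s≤s (+-monoʳ-≤ (cnt j O) (cnt-length b A)) ⟩
      suc (cnt j O + length A)      ≡⟨ cong (λ k → suc (cnt j O + k)) (cnt-all (All.map (λ p → ≤-trans i≤y (<⇒≤ p)) yA)) ⟨
      suc (cnt j O + cnt i A)       ≤⟨ s≤s le ⟩
      suc (cnt i B + cnt j A)       ≤⟨ s≤s (+-monoˡ-≤ (cnt j A) (cnt-anti B (<⇒≤ b<i))) ⟩
      suc (cnt b B + cnt j A)       ≡⟨ cong (_+ cnt j A) (cnt-≤ B (≤-refl {b})) ⟨
      cnt b (b ∷ B) + cnt j A       ∎)
Merge-tight {b ∷ B} {y ∷ A} {O = O} iB@(bB ∷ _) (yA ∷ iA) m@(pass y<b m′) j with ≤-<-connex j y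
... | inj₁ j≤y = j , ≤-refl , +-monoˡ-≤ (cnt j (y ∷ A)) (begin
      cnt j O             ≤⟨ cnt-length j O ⟩
      length O            ≡⟨ Merge-|O| m ⟩
      length (b ∷ B)      ≡⟨ cnt-all (j≤b ∷ All.map (λ p → ≤-trans j≤b (<⇒≤ p)) bB) ⟨
      cnt j (b ∷ B)       ∎)
  where j≤b = ≤-trans j≤y (<⇒≤ y<b)
... | inj₂ y<j rewrite cnt-> A y<j with i , i≤j , le ← Merge-tight iB iA m′ j with ≤-<-connex i y
...   | inj₂ y<i = i , i≤j , subst (λ k → cnt j O + k ≤ _) (sym (cnt-> A y<i)) le
-- Raising the threshold to `suc y` stops counting `y`, while every entry of `b ∷ B` exceeds `y` and
-- stays counted.
...   | inj₁ i≤y = suc y , y<j , (begin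
      cnt j O + cnt (suc y) (y ∷ A)       ≡⟨ cong (cnt j O +_) (cnt-> A ≤-refl) ⟩
      cnt j O + cnt (suc y) A             ≤⟨ +-monoʳ-≤ (cnt j O) (cnt-anti A (m≤n⇒m≤1+n i≤y)) ⟩
      cnt j O + cnt i A                   ≤⟨ le ⟩
      cnt i (b ∷ B) + cnt j A             ≤⟨ +-monoˡ-≤ (cnt j A) (cnt-length i (b ∷ B)) ⟩
      length (b ∷ B) + cnt j A            ≡⟨ cong (_+ cnt j A) (cnt-all (y<b ∷ All.map (<-trans y<b) bB)) ⟨
      cnt (suc y) (b ∷ B) + cnt j A       ∎)

cnt-++ : ∀ j xs ys → cnt j (xs ++ ys) ≡ cnt j xs + cnt j ys
cnt-++ j xs ys = trans (cong length (filter-++ (j ≤?_) xs ys)) (length-++ (filter (j ≤?_) xs))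

Merge-cnt : ∀ {B A C O} → Merge B A C O → ∀ j → cnt j C + cnt j O ≡ cnt j A + cnt j B
Merge-cnt {B} {A} {C} {O} m j =
  trans (sym (cnt-++ j C O)) (trans (cnt-↭ j (Merge-↭ m)) (cnt-++ j A B))

-- The comparison goes through `B`. Adding `Merge-tight` for the second merge, `Dom D B` at `i` and
-- `Merge-O⊆A` for the first merge, and using conservation of entries at both thresholds, gives
-- `cnt j O′ ≤ cnt j B`; `Merge-B≤O` finishes.
Merge-Dom : ∀ {D B A C O C′ O′} → Inc A → Inc B → Inc D →
            Merge B A C O → Merge D C C′ O′ → Dom D B → Dom O′ O
Merge-Dom {D} {B} {A} {C} {O} {O′ = O′} iA iB iD m m′ d j
  with i , i≤j , le ← Merge-tight iD (Merge-IncC m iB iA) m′ j =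
  ≤-trans (+-cancelʳ-≤ K _ _ (begin
    cnt j O′ + (cnt i C + cnt i O + cnt j O + cnt j A)
      ≡⟨ solve 5 (λ a b c d e → a :+ (b :+ c :+ d :+ e) := (a :+ b) :+ (c :+ e) :+ d) refl
           (cnt j O′) (cnt i C) (cnt i O) (cnt j O) (cnt j A) ⟩
    (cnt j O′ + cnt i C) + (cnt i O + cnt j A) + cnt j O
      ≤⟨ +-monoˡ-≤ (cnt j O) (+-mono-≤ (≤-trans le (+-monoˡ-≤ (cnt j C) (d i))) (Merge-O⊆A i≤j m)) ⟩
    (cnt i B + cnt j C) + (cnt i A + cnt j O) + cnt j O
      ≡⟨ solve 5 (λ a b c d e → (a :+ b) :+ (c :+ d) :+ d := (c :+ a) :+ (b :+ d) :+ d) refl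
           (cnt i B) (cnt j C) (cnt i A) (cnt j O) 0 ⟩
    (cnt i A + cnt i B) + (cnt j C + cnt j O) + cnt j O
      ≡⟨ cong₂ (λ p q → p + q + cnt j O) (sym (Merge-cnt m i)) (Merge-cnt m j) ⟩
    (cnt i C + cnt i O) + (cnt j A + cnt j B) + cnt j O
      ≡⟨ solve 5 (λ a b c d e → (a :+ b) :+ (c :+ d) :+ e := d :+ (a :+ b :+ e :+ c)) refl
           (cnt i C) (cnt i O) (cnt j A) (cnt j B) (cnt j O) ⟩
    cnt j B + K  ∎)) (Merge-B≤O m j)
  where K = cnt i C + cnt i O + cnt j O + cnt j A

Dom-above : ∀ {B y A} → All (y <_) A → length B ≤ length A → (∀ j → y < j → cnt j B ≤ cnt j A) → Dom B A
Dom-above {B} {y} {A} yA l d j with ≤-<-connex j y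
... | inj₂ y<j = d j y<j
... | inj₁ j≤y = ≤-trans (cnt-length j B)
                   (subst (length B ≤_) (sym (cnt-all (All.map (λ p → ≤-trans j≤y (<⇒≤ p)) yA))) l)

-- The greedy merge never runs out of column: a bump removes one entry from each side, and an entry
-- that is passed lies below all of the remaining word.
mergeDom : ∀ {B A} → Inc B → Inc A → Dom B A → ∃[ C ] ∃[ O ] Merge B A C O
mergeDom {[]}    _ _ _ = _ , _ , done
mergeDom {b ∷ B} {[]} _ _ d with () ← ≤-trans (≤-reflexive (sym (cnt-≤ B (≤-refl {b})))) (d b)
mergeDom {b ∷ B} {y ∷ A} (bB ∷ iB) (yA ∷ iA) d with ≤-<-connex b y
... | inj₁ b≤y with _ , _ , m ← mergeDom iB iA (Dom-above {B} yA (s≤s⁻¹ (Dom-length {y ∷ A} {b ∷ B} d)) λ j y<j →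
      subst₂ _≤_ (cnt-> B (≤-<-trans b≤y y<j)) (cnt-> A y<j) (d j)) = _ , _ , bump b≤y m
... | inj₂ y<b with _ , _ , m ← mergeDom (bB ∷ iB) iA (Dom-above yA (begin
      length (b ∷ B)      ≡⟨ cnt-all (≤-refl ∷ All.map <⇒≤ bB) ⟨
      cnt b (b ∷ B)       ≤⟨ d b ⟩
      cnt b (y ∷ A)       ≡⟨ cnt-> A y<b ⟩
      cnt b A             ≤⟨ cnt-length b A ⟩
      length A            ∎) λ j y<j → subst (_ ≤_) (cnt-> A y<j) (d j)) = _ , _ , pass y<b m

-- The shape of Icol (rw M)

InsW-++ : ∀ {u v c o c′ o′ c″} → InsW u c o c′ → InsW v c′ o′ c″ → InsW (u ++ v) c (o ++ o′) c″
InsW-++ [] js = js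
InsW-++ {o′ = o′} (_∷_ {o = p} {o′ = q} i is) js =
  subst (λ r → InsW _ _ r _) (sym (++-assoc p q o′)) (i ∷ InsW-++ is js)

Dom-trans : ∀ {C B A} → Dom C B → Dom B A → Dom C A
Dom-trans p q j = ≤-trans (p j) (q j)

-- The row B has already been merged into the column A; O is the row it bumped.
InsW-rows : ∀ {B A C O} Ms → Inc A → Inc B → All Inc Ms → Merge B A C O → NonWrapping (B ∷ Ms) →
            ∃[ Os ] ∃[ C′ ] InsW (rw Ms) C (rw Os) C′ × length C′ ≡ length C ×
            map length Os ≡ map length Ms × All Inc Os × NonWrapping (O ∷ Os)
InsW-rows [] _ _ _ _ _ = [] , _ , [] , refl , refl , [] , [-]
InsW-rows {B} {A} {C} {O} (D ∷ Ms) iA iB (iD ∷ iMs) m (d ∷ l)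
  with C′ , O′ , m′ ← mergeDom iD (Merge-IncC m iB iA) (Dom-trans {D} {B} {C} d (Merge-B≤C m))
  with Os , C″ , w , e , f , i , l′ ← InsW-rows Ms (Merge-IncC m iB iA) iD iMs m′ l =
  O′ ∷ Os , C″ , InsW-++ (Merge-InsW iD m′) w , trans e (Merge-|C| m′) , cong₂ _∷_ (Merge-|O| m′) f ,
  Merge-IncO m′ (Merge-IncC m iB iA) ∷ i , Merge-Dom iA iB iD m m′ d ∷ l′

Icol-first : ∀ {B} w → NonEmpty B → Inc B → ∀ {o C} → InsW w B o C → Icol (B ++ w) ≡ C ∷ Icol o
Icol-first {x ∷ B} w _ iB is =
  trans (⇐-++ [] (x ∷ B) w) (trans (cong (_⇐ w) (InsW-⇐ [] (InsW-[] iB))) (InsW-⇐ [] is))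

Icol-shape : ∀ M → All Inc M → All NonEmpty M → NonWrapping M → map length (Icol (rw M)) ≡ map length M
-- The recursion continues with the bumped rows, which are not a part of `M`; the number of rows
-- decreases instead.
Icol-shape M = go (length M) M refl
  where
  go : ∀ k M → length M ≡ k → All Inc M → All NonEmpty M → NonWrapping M → map length (Icol (rw M)) ≡ map length M
  go _ [] _ _ _ _ = refl
  go _ (B ∷ []) _ (iB ∷ []) (nB ∷ []) _ rewrite Icol-first [] nB iB [] = refl
  go (suc k) (A ∷ B ∷ Ms) e (iA ∷ iB ∷ i) (nA ∷ n) (d ∷ l)
    with C , O , m ← mergeDom iB iA d
    with Os , C′ , w , |C′| , |Os| , iOs , l′ ← InsW-rows Ms iA iB i m l =
    trans (cong (map length) (Icol-first (B ++ rw Ms) nA iA (InsW-++ (Merge-InsW iB m) w)))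
          (cong₂ _∷_ (trans |C′| (Merge-|C| m)) (trans
            (go k (O ∷ Os) (trans |O∷Os| (suc-injective e)) (Merge-IncO m iA ∷ iOs)
               (All.map⁻ (subst (All (0 <_)) (sym lengths) (All.map⁺ n))) l′) lengths))
    where
    lengths : map length (O ∷ Os) ≡ map length (B ∷ Ms)
    lengths = cong₂ _∷_ (Merge-|O| m) |Os|
    |O∷Os| : length (O ∷ Os) ≡ length (B ∷ Ms)
    |O∷Os| = trans (sym (length-map length (O ∷ Os))) (trans (cong length lengths) (length-map length (B ∷ Ms)))

-- Parenthesis words, read from the right with a count of free closing parentheses

Par : Set
Par = List (Bool × ℕ)

push keep : ℕ → ℕ → List ℕ → List ℕ
push zero    a U = a ∷ U
push (suc _) a U = U
keep zero    a B = B
keep (suc _) a B = a ∷ B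

-- An opening parenthesis is unmatched exactly when `free` of the word to its right is zero; `pred`
-- then keeps zero, and otherwise uses up the partner. `lower` and `upper` are the two rows after
-- `estar`.
opens closes unm lower upper : Par → List ℕ
free : Par → ℕ

opens []                = []
opens ((true  , a) ∷ p) = a ∷ opens p
opens ((false , a) ∷ p) = opens p

closes []                = []
closes ((true  , a) ∷ p) = closes p
closes ((false , a) ∷ p) = a ∷ closes p

free []                = 0
free ((true  , _) ∷ p) = pred (free p)
free ((false , _) ∷ p) = suc (free p)

unm []                = []
unm ((true  , a) ∷ p) = push (free p) a (unm p)
unm ((false , a) ∷ p) = unm p

lower []                = []
lower ((true  , a) ∷ p) = push (free p) a (lower p)
lower ((false , a) ∷ p) = a ∷ lower p

upper []                = []
upper ((true  , a) ∷ p) = keep (free p) a (upper p)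
upper ((false , a) ∷ p) = upper p

-- At equal positions an opening parenthesis precedes a closing one.
infix 4 _≺_
data _≺_ : Bool × ℕ → Bool × ℕ → Set where
  lt : ∀ {s t a b} → a < b → (s , a) ≺ (t , b)
  le : ∀ {a b} → a ≤ b → (true , a) ≺ (false , b)

Sorted : Par → Set
Sorted = AllPairs _≺_

≺⇒≤ : ∀ {u v} → u ≺ v → proj₂ u ≤ proj₂ v
≺⇒≤ (lt p) = <⇒≤ p
≺⇒≤ (le p) = p

≺⇒< : ∀ {t a b} → (t , a) ≺ (t , b) → a < b
≺⇒< (lt p) = p

≺false⇒< : ∀ {v a} → (false , a) ≺ v → a < proj₂ v
≺false⇒< (lt p) = p

module _ {P : ℕ → Set} where

  push-All : ∀ k {a U} → P a → All P U → All P (push k a U)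
  push-All zero    pa pU = pa ∷ pU
  push-All (suc _) pa pU = pU

  keep-All : ∀ k {a U} → P a → All P U → All P (keep k a U)
  keep-All zero    pa pU = pU
  keep-All (suc _) pa pU = pa ∷ pU

  lower-All : ∀ {p} → All (λ q → P (proj₂ q)) p → All P (lower p)
  lower-All {[]}              []       = []
  lower-All {(true , a) ∷ p}  (x ∷ xs) = push-All (free p) x (lower-All xs)
  lower-All {(false , a) ∷ p} (x ∷ xs) = x ∷ lower-All xs

  -- A closing parenthesis may share its position with an opening one before it, so after an opening
  -- one strict bounds hold only for opening ones.
  OnOpens : Bool × ℕ → Set
  OnOpens (t , a) = t ≡ true → P a

  opens-All : ∀ {p} → All OnOpens p → All P (opens p)
  opens-All {[]}              []       = []
  opens-All {(true , a) ∷ p}  (x ∷ xs) = x refl ∷ opens-All xs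
  opens-All {(false , a) ∷ p} (x ∷ xs) = opens-All xs

  upper-All : ∀ {p} → All OnOpens p → All P (upper p)
  upper-All {[]}              []       = []
  upper-All {(true , a) ∷ p}  (x ∷ xs) = keep-All (free p) (x refl) (upper-All xs)
  upper-All {(false , a) ∷ p} (x ∷ xs) = upper-All xs

  unm-All : ∀ {p} → All OnOpens p → All P (unm p)
  unm-All {[]}              []       = []
  unm-All {(true , a) ∷ p}  (x ∷ xs) = push-All (free p) (x refl) (unm-All xs)
  unm-All {(false , a) ∷ p} (x ∷ xs) = unm-All xs

  closes-All : ∀ {p} → All (λ q → P (proj₂ q)) p → All P (closes p)
  closes-All {[]}              []       = []
  closes-All {(true , a) ∷ p}  (x ∷ xs) = closes-All xs
  closes-All {(false , a) ∷ p} (x ∷ xs) = x ∷ closes-All xs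

≺-OnOpens : ∀ {a v} → (true , a) ≺ v → OnOpens {a <_} v
≺-OnOpens q refl = ≺⇒< q

false≺-OnOpens : ∀ {a v} → (false , a) ≺ v → OnOpens {a <_} v
false≺-OnOpens q refl = ≺⇒< (weaken q)
  where
  weaken : ∀ {a v} → (false , a) ≺ v → (proj₁ v , a) ≺ v
  weaken (lt p) = lt p

-- With no free closing parenthesis, the first position of p is an opening one.
free0-lower : ∀ {a p} → Sorted ((true , a) ∷ p) → free p ≡ 0 → All (a <_) (lower p)
free0-lower {p = []} _ _ = []
free0-lower {p = (true , b) ∷ p} ((q ∷ _) ∷ r ∷ _) e =
  lower-All (≺⇒< q ∷ All.map (λ s → <-≤-trans (≺⇒< q) (≺⇒≤ s)) r)

lower-Inc : ∀ {p} → Sorted p → Inc (lower p)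
lower-Inc {[]} _ = []
lower-Inc {(false , a) ∷ p} (q ∷ s) = lower-All (All.map ≺false⇒< q) ∷ lower-Inc s
lower-Inc {(true , a) ∷ p} (q ∷ s) with free p in e
... | zero  = free0-lower (q ∷ s) e ∷ lower-Inc s
... | suc _ = lower-Inc s

upper-Inc : ∀ {p} → Sorted p → Inc (upper p)
upper-Inc {[]} _ = []
upper-Inc {(false , a) ∷ p} (q ∷ s) = upper-Inc s
upper-Inc {(true , a) ∷ p} (q ∷ s) with free p
... | zero  = upper-Inc s
... | suc _ = upper-All (All.map ≺-OnOpens q) ∷ upper-Inc s

-- Moving the unmatched opening parentheses preserves the Knuth class

-- Insertion of j from the left, which bumps y to the right end (y ≤ j).
slideʳ : ∀ {y j A} → y ≤ j → Inc (j ∷ A) → j ∷ y ∷ A ≈ j ∷ A ++ [ y ]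
slideʳ {A = []}    _   _ = ≈refl
slideʳ {y} {j} {a ∷ A} y≤j ((j<a ∷ _) ∷ iA) =
  ≈trans (≈sym (k₂ y≤j j<a A)) (cons j (slideʳ (≤-trans y≤j (<⇒≤ j<a)) iA))

-- The letter `j` travels right through `X` by `k₁`, with the next letter of `X`, or finally `y`, as
-- middle value; once beside `y` it sends `y` to the end.
slideˡ : ∀ {X y j A} → Inc X → All (_< y) X → y ≤ j → Inc (j ∷ A) →
         j ∷ X ++ y ∷ A ≈ (X ++ j ∷ A) ++ [ y ]
slideˡ {[]} _ _ y≤j iA = slideʳ y≤j iA
slideˡ {x ∷ []} _ (x<y ∷ _) y≤j iA = ≈trans (≈sym (k₁ x<y y≤j _)) (cons x (slideʳ y≤j iA))
slideˡ {x ∷ x′ ∷ X} ((x<x′ ∷ _) ∷ iX) (_ ∷ x′<y ∷ X<y) y≤j iA =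
  ≈trans (≈sym (k₁ x<x′ (<⇒≤ (<-≤-trans x′<y y≤j)) _)) (cons x (slideˡ iX (x′<y ∷ X<y) y≤j iA))

opening : List ℕ → Par
opening = map (true ,_)

AllPairs-++⁻ʳ : ∀ {A : Set} {R : A → A → Set} xs {ys} → AllPairs R (xs ++ ys) → AllPairs R ys
AllPairs-++⁻ʳ []       s       = s
AllPairs-++⁻ʳ (x ∷ xs) (_ ∷ s) = AllPairs-++⁻ʳ xs s

drop-mid : ∀ {A : Set} {R : A → A → Set} xs {y ys} → AllPairs R (xs ++ y ∷ ys) → AllPairs R (xs ++ ys)
drop-mid []       (_ ∷ s) = s
drop-mid (x ∷ xs) (q ∷ s) with q₁ , _ ∷ q₂ ← All.++⁻ xs q = All.++⁺ q₁ q₂ ∷ drop-mid xs s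

opening-∷ʳ : ∀ Z a p → opening (Z ++ [ a ]) ++ p ≡ opening Z ++ (true , a) ∷ p
opening-∷ʳ Z a p = trans (cong (_++ p) (map-++ (true ,_) Z [ a ])) (++-assoc (opening Z) _ p)

-- Of the further opening parentheses X ++ Y to the left of p, exactly those of Y get matched in p.
lower-upper-≈ : ∀ p X Y → Sorted (opening (X ++ Y) ++ p) → length Y ≤ free p → X ≡ [] ⊎ length Y ≡ free p →
                closes p ++ X ++ Y ++ opens p ≈ X ++ lower p ++ Y ++ upper p
lower-upper-≈ [] X [] _ _ _ = ≈refl
lower-upper-≈ ((true , a) ∷ p) X Y s l c with free p in e
lower-upper-≈ ((true , a) ∷ p) X [] s l c | zero =
  ≈trans (≡⇒≈ (cong (closes p ++_) (sym (++-assoc X [ a ] (opens p)))))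
  (≈trans (lower-upper-≈ p (X ++ [ a ]) [] (subst Sorted reassoc s) z≤n (inj₂ (sym e)))
          (≡⇒≈ (++-assoc X [ a ] (lower p ++ upper p))))
  where
  reassoc : opening (X ++ []) ++ (true , a) ∷ p ≡ opening ((X ++ [ a ]) ++ []) ++ p
  reassoc = trans (cong (λ Z → opening Z ++ (true , a) ∷ p) (++-identityʳ X))
                  (sym (trans (cong (λ Z → opening Z ++ p) (++-identityʳ (X ++ [ a ]))) (opening-∷ʳ X a p)))
lower-upper-≈ ((true , a) ∷ p) X Y s l c | suc k =
  ≈trans (≡⇒≈ (cong (λ w → closes p ++ X ++ w) (sym (++-assoc Y [ a ] (opens p)))))
  (≈trans (lower-upper-≈ p X (Y ++ [ a ]) (subst Sorted reassoc s)
             (subst₂ _≤_ (sym |Y∷ʳa|) (sym e) (s≤s l)) (map₂ (λ q → trans |Y∷ʳa| (trans (cong suc q) (sym e))) c))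
          (≡⇒≈ (cong (λ w → X ++ lower p ++ w) (++-assoc Y [ a ] (upper p)))))
  where
  |Y∷ʳa| : length (Y ++ [ a ]) ≡ suc (length Y)
  |Y∷ʳa| = trans (length-++ Y) (+-comm (length Y) 1)
  reassoc : opening (X ++ Y) ++ (true , a) ∷ p ≡ opening (X ++ Y ++ [ a ]) ++ p
  reassoc = sym (trans (cong (λ Z → opening Z ++ p) (sym (++-assoc X Y [ a ]))) (opening-∷ʳ (X ++ Y) a p))
lower-upper-≈ ((false , j) ∷ p) X Y s l c with length Y ≤? free p
lower-upper-≈ ((false , j) ∷ p) X Y s l (inj₂ c) | yes l′ = contradiction l′ (<⇒≱ (≤-reflexive (sym c)))
lower-upper-≈ ((false , j) ∷ p) [] Y s l (inj₁ refl) | yes l′ =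
  cons j (lower-upper-≈ p [] Y (drop-mid (opening Y) s) l′ (inj₁ refl))
lower-upper-≈ ((false , j) ∷ p) X [] s l c | no l′ = contradiction z≤n l′
lower-upper-≈ ((false , j) ∷ p) X (y ∷ Y) s l c | no l′ =
  ≈trans (cons j (≈trans (≡⇒≈ (cong (closes p ++_) (sym (++-assoc X [ y ] (Y ++ opens p)))))
                 (≈trans (lower-upper-≈ p (X ++ [ y ]) Y
                            (subst (λ Z → Sorted (opening Z ++ p)) (sym (++-assoc X [ y ] Y)) (drop-mid (opening (X ++ y ∷ Y)) s))
                            (s≤s⁻¹ l) (inj₂ (≤-antisym (s≤s⁻¹ l) (s≤s⁻¹ (≰⇒> l′)))))
                         (≡⇒≈ (trans (++-assoc X [ y ] _) (sym (++-assoc X (y ∷ lower p) (Y ++ upper p))))))))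
  (≈trans (≈-++ʳ (Y ++ upper p) (slideˡ iX X<y y≤j iA))
          (≡⇒≈ (trans (++-assoc (X ++ j ∷ lower p) [ y ] _) (++-assoc X (j ∷ lower p) (y ∷ Y ++ upper p)))))
  where
  facts : ∀ X → Sorted (opening (X ++ y ∷ Y) ++ (false , j) ∷ p) → Inc X × All (_< y) X × y ≤ j × Inc (j ∷ lower p)
  facts [] (q ∷ s) = [] , [] , ≺⇒≤ (All.head (All.++⁻ʳ (opening Y) q)) , lower-Inc (AllPairs-++⁻ʳ (opening Y) s)
  facts (x ∷ X) (q ∷ s) with iX , X<y , rest ← facts X s =
    All.++⁻ˡ X below ∷ iX , All.head (All.++⁻ʳ X below) ∷ X<y , rest
    where
    below : All (x <_) (X ++ y ∷ Y)
    below = All.map ≺⇒< (All.map⁻ (All.++⁻ˡ (opening (X ++ y ∷ Y)) q))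
  iX = proj₁ (facts X s)
  X<y = proj₁ (proj₂ (facts X s))
  y≤j = proj₁ (proj₂ (proj₂ (facts X s)))
  iA = proj₂ (proj₂ (proj₂ (facts X s)))

row-move-≈ : ∀ p → Sorted p → closes p ++ opens p ≈ lower p ++ upper p
row-move-≈ p s = lower-upper-≈ p [] [] s z≤n (inj₁ refl)

-- Counting the moved entries

lower-↭ : ∀ p → lower p ↭ closes p ++ unm p
lower-↭ [] = ↭-refl
lower-↭ ((false , a) ∷ p) = prep a (lower-↭ p)
lower-↭ ((true , a) ∷ p) with free p
... | zero  = ↭-trans (prep a (lower-↭ p)) (↭-sym (shift a (closes p) (unm p)))
... | suc _ = lower-↭ p

opens-↭ : ∀ p → opens p ↭ upper p ++ unm p
opens-↭ [] = ↭-refl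
opens-↭ ((false , a) ∷ p) = opens-↭ p
opens-↭ ((true , a) ∷ p) with free p
... | zero  = ↭-trans (prep a (opens-↭ p)) (↭-sym (shift a (upper p) (unm p)))
... | suc _ = prep a (opens-↭ p)

cnt-lower : ∀ p j → cnt j (lower p) ≡ cnt j (closes p) + cnt j (unm p)
cnt-lower p j = trans (cnt-↭ j (lower-↭ p)) (cnt-++ j (closes p) (unm p))

cnt-opens : ∀ p j → cnt j (opens p) ≡ cnt j (upper p) + cnt j (unm p)
cnt-opens p j = trans (cnt-↭ j (opens-↭ p)) (cnt-++ j (upper p) (unm p))

-- Both sides are the number of matched pairs plus the unmatched parentheses of both kinds.
opens-free : ∀ p → length (opens p) + free p ≡ length (closes p) + length (unm p)
opens-free [] = refl
opens-free ((false , a) ∷ p) = trans (+-suc _ _) (cong suc (opens-free p))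
opens-free ((true , a) ∷ p) with free p | opens-free p
... | zero  | e = trans (cong suc e) (sym (+-suc _ _))
... | suc k | e = trans (sym (+-suc _ k)) e

module _ {t : Bool} {a : ℕ} {p : Par} (s : Sorted ((t , a) ∷ p)) {j : ℕ} (j≤a : j ≤ a) where

  private
    above : All (λ q → j ≤ proj₂ q) ((t , a) ∷ p)
    above = j≤a ∷ All.map (λ q → ≤-trans j≤a (≺⇒≤ q)) (AllPairs.head s)

  cnt-opens-all : cnt j (opens ((t , a) ∷ p)) ≡ length (opens ((t , a) ∷ p))
  cnt-opens-all = cnt-all (opens-All (All.map (λ q _ → q) above))

  cnt-closes-all : cnt j (closes ((t , a) ∷ p)) ≡ length (closes ((t , a) ∷ p))
  cnt-closes-all = cnt-all (closes-All above)

  cnt-unm-all : cnt j (unm ((t , a) ∷ p)) ≡ length (unm ((t , a) ∷ p))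
  cnt-unm-all = cnt-all (unm-All (All.map (λ q _ → q) above))

cnt-push : ∀ k {j a} U → a < j → cnt j (push k a U) ≡ cnt j U
cnt-push zero    U p = cnt-> U p
cnt-push (suc _) U p = refl

-- The partner of a matched opening parenthesis lies weakly to its right; formally, `opens-free` is
-- applied to the part of `p` at positions at least `j`.
upper≤closes : ∀ p → Sorted p → ∀ j → cnt j (opens p) ≤ cnt j (closes p) + cnt j (unm p)
upper≤closes [] _ j = z≤n
upper≤closes ((t , a) ∷ p) s j with ≤-<-connex j a
... | inj₁ j≤a = begin
  cnt j (opens q)                    ≡⟨ cnt-opens-all s j≤a ⟩
  length (opens q)                   ≤⟨ m≤m+n _ (free q) ⟩
  length (opens q) + free q          ≡⟨ opens-free q ⟩
  length (closes q) + length (unm q) ≡⟨ cong₂ _+_ (cnt-closes-all s j≤a) (cnt-unm-all s j≤a) ⟨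
  cnt j (closes q) + cnt j (unm q)   ∎
  where q = (t , a) ∷ p
upper≤closes ((true , a) ∷ p) (_ ∷ s) j | inj₂ a<j
  rewrite cnt-> (opens p) a<j | cnt-push (free p) (unm p) a<j = upper≤closes p s j
upper≤closes ((false , a) ∷ p) (_ ∷ s) j | inj₂ a<j
  rewrite cnt-> (closes p) a<j = upper≤closes p s j

-- `cnt j (unm p)` is the largest excess, or zero, of opening over closing parentheses beyond a
-- threshold `i ≥ j`, and `f j` bounds every such excess.
unm-least : ∀ p → Sorted p → (f : ℕ → ℕ) → (∀ {i j} → i ≤ j → f j ≤ f i) → ∀ j →
            (∀ i → j ≤ i → cnt i (opens p) ≤ cnt i (closes p) + f i) → cnt j (unm p) ≤ f j
unm-least [] _ f _ j _ = z≤n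
unm-least ((false , a) ∷ p) (q ∷ s) f anti j h with ≤-<-connex j a
... | inj₂ a<j = unm-least p s f anti j λ i j≤i → subst (λ k → _ ≤ k + f i) (cnt-> (closes p) (<-≤-trans a<j j≤i)) (h i j≤i)
-- All opening parentheses after a closing one at `a` lie beyond `a`, so the threshold may move to
-- `suc a`, where that closing one no longer counts.
... | inj₁ j≤a = begin
  cnt j (unm p)        ≤⟨ cnt-length j (unm p) ⟩
  length (unm p)       ≡⟨ cnt-all (unm-All (All.map false≺-OnOpens q)) ⟨
  cnt (suc a) (unm p)  ≤⟨ unm-least p s f anti (suc a) (λ i a<i → subst (λ k → _ ≤ k + f i) (cnt-> (closes p) a<i)
                            (h i (≤-trans j≤a (<⇒≤ a<i)))) ⟩
  f (suc a)            ≤⟨ anti (≤-trans j≤a (n≤1+n a)) ⟩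
  f j                  ∎
unm-least ((true , a) ∷ p) s′@(q ∷ s) f anti j h with ≤-<-connex j a
... | inj₂ a<j rewrite cnt-push (free p) (unm p) a<j =
  unm-least p s f anti j λ i j≤i → subst (_≤ _) (cnt-> (opens p) (<-≤-trans a<j j≤i)) (h i j≤i)
... | inj₁ j≤a = go (free p) refl
  where
  r = (true , a) ∷ p
  go : ∀ k → free p ≡ k → cnt j (push k a (unm p)) ≤ f j
  go (suc k) _ = unm-least p s f anti j λ i j≤i → ≤-trans (cnt-tail i a (opens p)) (h i j≤i)
  go zero    e = +-cancelˡ-≤ (length (closes p)) _ _ (begin
    length (closes p) + cnt j (push 0 a (unm p))   ≤⟨ +-monoʳ-≤ (length (closes p)) (cnt-length j (push 0 a (unm p))) ⟩
    length (closes p) + length (push 0 a (unm p))  ≡⟨ cong (λ k → length (closes p) + length (push k a (unm p))) e ⟨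
    length (closes r) + length (unm r)             ≡⟨ opens-free r ⟨
    length (opens r) + pred (free p)               ≡⟨ cong (λ k → length (opens r) + pred k) e ⟩
    length (opens r) + 0                           ≡⟨ +-identityʳ _ ⟩
    length (opens r)                               ≡⟨ cnt-opens-all s′ j≤a ⟨
    cnt j (opens r)                                ≤⟨ h j ≤-refl ⟩
    cnt j (closes r) + f j                         ≡⟨ cong (_+ f j) (cnt-closes-all s′ j≤a) ⟩
    length (closes p) + f j                        ∎)

-- Iterated matching computes unm

matchOnce-free : ∀ p → free (matchOnce p) ≡ free p
matchOnce-free []                             = refl
matchOnce-free ((true , a) ∷ [])              = refl
matchOnce-free ((true , a) ∷ (false , b) ∷ p) = refl
matchOnce-free ((true , a) ∷ (true , b) ∷ p)  = cong pred (matchOnce-free ((true , b) ∷ p))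
matchOnce-free ((false , a) ∷ p)              = cong suc (matchOnce-free p)

matchOnce-unm : ∀ p → unm (matchOnce p) ≡ unm p
matchOnce-unm []                             = refl
matchOnce-unm ((true , a) ∷ [])              = refl
matchOnce-unm ((true , a) ∷ (false , b) ∷ p) = refl
matchOnce-unm ((true , a) ∷ (true , b) ∷ p)  =
  cong₂ (λ k U → push k a U) (matchOnce-free ((true , b) ∷ p)) (matchOnce-unm ((true , b) ∷ p))
matchOnce-unm ((false , a) ∷ p)              = matchOnce-unm p

matchOnce-shrinks : ∀ p → matchOnce p ≡ p ⊎ length (matchOnce p) < length p
matchOnce-shrinks []                             = inj₁ refl
matchOnce-shrinks ((true , a) ∷ [])              = inj₁ refl
matchOnce-shrinks ((true , a) ∷ (false , b) ∷ p) = inj₂ (s≤s (n≤1+n _))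
matchOnce-shrinks ((true , a) ∷ (true , b) ∷ p) with matchOnce-shrinks ((true , b) ∷ p)
... | inj₁ e = inj₁ (cong ((true , a) ∷_) e)
... | inj₂ l = inj₂ (s≤s l)
matchOnce-shrinks ((false , a) ∷ p) with matchOnce-shrinks p
... | inj₁ e = inj₁ (cong ((false , a) ∷_) e)
... | inj₂ l = inj₂ (s≤s l)

iterate-unm : ∀ k p → unm (iterate k matchOnce p) ≡ unm p
iterate-unm zero    p = refl
iterate-unm (suc k) p = trans (iterate-unm k (matchOnce p)) (matchOnce-unm p)

iterate-fixed : ∀ k p → matchOnce p ≡ p → iterate k matchOnce p ≡ p
iterate-fixed zero    p e = refl
iterate-fixed (suc k) p e = trans (cong (iterate k matchOnce) e) (iterate-fixed k p e)

-- A round either changes nothing or shortens the word, so `length p` rounds reach a fixed point.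
iterate-reduced : ∀ k p → length p ≤ k → matchOnce (iterate k matchOnce p) ≡ iterate k matchOnce p
iterate-reduced zero    [] _ = refl
iterate-reduced (suc k) p  l with matchOnce-shrinks p
... | inj₁ e rewrite e | iterate-fixed k p e = e
... | inj₂ m = iterate-reduced k (matchOnce p) (s≤s⁻¹ (≤-trans m l))

-- In a fixed word no closing parenthesis comes after an opening one.
reduced-free : ∀ {a p} → matchOnce ((true , a) ∷ p) ≡ (true , a) ∷ p → free p ≡ 0
reduced-free {p = []} _ = refl
reduced-free {p = (false , b) ∷ p} e = contradiction (cong length e) (<⇒≢ (s≤s (n≤1+n _)))
reduced-free {p = (true , b) ∷ p} e = cong pred (reduced-free {b} {p} (∷-injectiveʳ e))

isOpen? : (t : Bool × ℕ) → Dec (proj₁ t ≡ true)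
isOpen? t = proj₁ t ≟ true

reduced-unm : ∀ p → matchOnce p ≡ p → map proj₂ (filter isOpen? p) ≡ unm p
reduced-unm [] _ = refl
reduced-unm ((false , a) ∷ p) e = reduced-unm p (∷-injectiveʳ e)
reduced-unm ((true , a) ∷ []) e = refl
reduced-unm ((true , a) ∷ (false , b) ∷ p) e = contradiction (cong length e) (<⇒≢ (s≤s (n≤1+n _)))
reduced-unm ((true , a) ∷ (true , b) ∷ p) e =
  trans (cong (a ∷_) (reduced-unm ((true , b) ∷ p) (∷-injectiveʳ e)))
        (cong (λ k → push k a (unm ((true , b) ∷ p))) (sym (reduced-free {a} e)))

unmatchedPar-unm : ∀ p → map proj₂ (filter isOpen? (unmatchedPar p)) ≡ unm p
unmatchedPar-unm p = trans (reduced-unm _ (iterate-reduced (length p) p ≤-refl)) (iterate-unm (length p) p)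

-- The two rows after the move

≡ᵇ-refl : ∀ n → (n ≡ᵇ n) ≡ true
≡ᵇ-refl zero    = refl
≡ᵇ-refl (suc n) = ≡ᵇ-refl n

≢⇒≡ᵇ : ∀ {m n} → m ≢ n → (m ≡ᵇ n) ≡ false
≢⇒≡ᵇ {m} {n} m≢n with m ≡ᵇ n in e
... | false = refl
... | true  = contradiction (≡ᵇ⇒≡ m n (subst T (sym e) _)) m≢n

insertSorted-< : ∀ {x ys} → All (x <_) ys → insertSorted x ys ≡ x ∷ ys
insertSorted-< [] = refl
insertSorted-< {x} {y ∷ ys} (p ∷ _) with x <ᵇ y | <⇒<ᵇ p
... | true | _ = refl

insertSorted-> : ∀ {x y} ys → y < x → insertSorted x (y ∷ ys) ≡ y ∷ insertSorted x ys
insertSorted-> {x} {y} ys p with x <ᵇ y in e | x ≡ᵇ y in f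
... | true  | _     = contradiction (<ᵇ⇒< x y (subst T (sym e) _)) (<-asym p)
... | false | true  = contradiction (≡ᵇ⇒≡ x y (subst T (sym f) _)) (>⇒≢ p)
... | false | false = refl

insertAll-∷ : ∀ {y} ys U → All (y <_) U → foldr insertSorted (y ∷ ys) U ≡ y ∷ foldr insertSorted ys U
insertAll-∷ ys [] _ = refl
insertAll-∷ ys (u ∷ U) (p ∷ ps) =
  trans (cong (insertSorted u) (insertAll-∷ ys U ps)) (insertSorted-> (foldr insertSorted ys U) p)

-- `insertSorted` drops duplicates, but an unmatched opening parenthesis never shares its position
-- with a closing one, so every letter of `unm p` is really inserted.
insertAll-lower : ∀ p → Sorted p → foldr insertSorted (closes p) (unm p) ≡ lower p
insertAll-lower [] _ = refl
insertAll-lower ((false , a) ∷ p) (q ∷ s) =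
  trans (insertAll-∷ (closes p) (unm p) (unm-All (All.map false≺-OnOpens q))) (cong (a ∷_) (insertAll-lower p s))
insertAll-lower ((true , a) ∷ p) (q ∷ s) with free p in e
... | suc _ = insertAll-lower p s
... | zero  = trans (cong (insertSorted a) (insertAll-lower p s)) (insertSorted-< (free0-lower (q ∷ s) e))

memb-< : ∀ {x ys} → All (x <_) ys → memb x ys ≡ false
memb-< [] = refl
memb-< {x} {y ∷ ys} (p ∷ ps) rewrite ≢⇒≡ᵇ (>⇒≢ p) = memb-< ps

notIn : List ℕ → List ℕ → List ℕ
notIn U = filter (λ x → memb x U ≟ false)

notIn-∷ : ∀ {a} U ys → All (a <_) ys → notIn (a ∷ U) ys ≡ notIn U ys
notIn-∷ U [] _ = refl
notIn-∷ {a} U (y ∷ ys) (p ∷ ps) rewrite ≢⇒≡ᵇ (<⇒≢ p) with memb y U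
... | true  = notIn-∷ U ys ps
... | false = cong (y ∷_) (notIn-∷ U ys ps)

notIn-upper : ∀ p → Sorted p → notIn (unm p) (opens p) ≡ upper p
notIn-upper [] _ = refl
notIn-upper ((false , a) ∷ p) (q ∷ s) = notIn-upper p s
notIn-upper ((true , a) ∷ p) (q ∷ s) with free p
... | zero rewrite ≡ᵇ-refl a = trans (notIn-∷ (unm p) (opens p) (opens-All (All.map ≺-OnOpens q))) (notIn-upper p s)
... | suc _ rewrite memb-< (unm-All (All.map ≺-OnOpens q)) = cong (a ∷_) (notIn-upper p s)

-- The parenthesis word of two adjacent rows

cell : Bool → Bool → ℕ → Par
cell b t j = (if b then [ (true , j) ] else []) ++ (if t then [ (false , j) ] else [])

-- Columns s, …, s + m − 1, for rows given by their characteristic functions.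
word : (up low : ℕ → Bool) → ℕ → ℕ → Par
word up low s zero    = []
word up low s (suc m) = cell (up s) (low s) s ++ word up low (suc s) m

word-≥ : ∀ up low s m → All (λ q → s ≤ proj₂ q) (word up low s m)
word-≥ up low s zero    = []
word-≥ up low s (suc m) with up s | low s | All.map <⇒≤ (word-≥ up low (suc s) m)
... | true  | true  | r = ≤-refl ∷ ≤-refl ∷ r
... | true  | false | r = ≤-refl ∷ r
... | false | true  | r = ≤-refl ∷ r
... | false | false | r = r

word-sorted : ∀ up low s m → Sorted (word up low s m)
word-sorted up low s zero    = []
word-sorted up low s (suc m) with up s | low s | word-≥ up low (suc s) m | word-sorted up low (suc s) m
... | true  | true  | r | i = (le ≤-refl ∷ All.map lt r) ∷ All.map lt r ∷ i
... | true  | false | r | i = All.map lt r ∷ i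
... | false | true  | r | i = All.map lt r ∷ i
... | false | false | r | i = i

select : (ℕ → Bool) → ℕ → ℕ → List ℕ
select f s zero    = []
select f s (suc m) = (if f s then [ s ] else []) ++ select f (suc s) m

opens-word : ∀ up low s m → opens (word up low s m) ≡ select up s m
opens-word up low s zero = refl
opens-word up low s (suc m) with up s | low s
... | true  | true  = cong (s ∷_) (opens-word up low (suc s) m)
... | true  | false = cong (s ∷_) (opens-word up low (suc s) m)
... | false | true  = opens-word up low (suc s) m
... | false | false = opens-word up low (suc s) m

closes-word : ∀ up low s m → closes (word up low s m) ≡ select low s m
closes-word up low s zero = refl
closes-word up low s (suc m) with up s | low s
... | true  | true  = cong (s ∷_) (closes-word up low (suc s) m)
... | true  | false = closes-word up low (suc s) m
... | false | true  = cong (s ∷_) (closes-word up low (suc s) m)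
... | false | false = closes-word up low (suc s) m

select-memb : ∀ {f B} s m → (∀ j → s ≤ j → f j ≡ memb j B) → Inc B → All (s ≤_) B → All (_< s + m) B → select f s m ≡ B
select-memb {B = []}    s zero _ _ _ _ = refl
select-memb {B = b ∷ B} s zero _ _ (p ∷ _) (q ∷ _) = contradiction p (<⇒≱ (subst (b <_) (+-identityʳ s) q))
select-memb {f} {[]} s (suc m) h i p q rewrite h s ≤-refl = select-memb (suc s) m (λ j r → h j (<⇒≤ r)) [] [] []
select-memb {f} {b ∷ B} s (suc m) h (bB ∷ i) (s≤b ∷ p) q with s ℕ.≟ b
... | yes refl rewrite h s ≤-refl | ≡ᵇ-refl s = cong (s ∷_)
  (select-memb (suc s) m (λ j r → trans (h j (<⇒≤ r)) (cong (λ t → t ∨ memb j B) (≢⇒≡ᵇ (<⇒≢ r)))) i bB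
     (subst (λ k → All (_< k) B) (+-suc s m) (All.tail q)))
... | no s≢b with s<b ← ≤∧≢⇒< s≤b s≢b rewrite h s ≤-refl | memb-< (s<b ∷ All.map (<-trans s<b) bB) =
  select-memb (suc s) m (λ j r → h j (<⇒≤ r)) (bB ∷ i) (s<b ∷ All.map (<-trans s<b) bB)
     (subst (λ k → All (_< k) (b ∷ B)) (+-suc s m) q)

parens-++ : ∀ i u v → parens i (u ++ v) ≡ parens i u ++ parens i v
parens-++ i [] v = refl
parens-++ i ((r , j) ∷ u) v with r ≡ᵇ suc i | r ≡ᵇ i
... | true  | _     = cong (_ ∷_) (parens-++ i u v)
... | false | true  = cong (_ ∷_) (parens-++ i u v)
... | false | false = parens-++ i u v

-- Rows are counted from 0 by f, while the letters of the column word count them from 1.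
entry : (ℕ → Bool) → ℕ → ℕ → List (ℕ × ℕ)
entry f j r = if f (r ∸ 1) then [ (r , j) ] else []

column : (ℕ → Bool) → ℕ → ℕ → List (ℕ × ℕ)
column f j L = concatMap (entry f j) (map suc (downFrom L))

module _ (f : ℕ → Bool) (i j : ℕ) where

  parens-other : ∀ r → r ≢ suc i → r ≢ i → parens (suc i) (entry f j (suc r)) ≡ []
  parens-other r p q with f r
  ... | false = refl
  ... | true rewrite ≢⇒≡ᵇ p | ≢⇒≡ᵇ q = refl

  parens-column-below : ∀ L → L ≤ i → parens (suc i) (column f j L) ≡ []
  parens-column-below zero    _ = refl
  parens-column-below (suc L) p =
    trans (parens-++ (suc i) (entry f j (suc L)) (column f j L))
          (cong₂ _++_ (parens-other L (<⇒≢ (m≤n⇒m≤1+n p)) (<⇒≢ p)) (parens-column-below L (<⇒≤ p)))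

  parens-column-low : parens (suc i) (column f j (suc i)) ≡ cell false (f i) j
  parens-column-low =
    trans (parens-++ (suc i) (entry f j (suc i)) (column f j i))
          (trans (cong (parens (suc i) (entry f j (suc i)) ++_) (parens-column-below i ≤-refl)) (trans (++-identityʳ _) low))
    where
    low : parens (suc i) (entry f j (suc i)) ≡ cell false (f i) j
    low with f i
    ... | false = refl
    ... | true rewrite ≢⇒≡ᵇ {i} {suc i} (<⇒≢ ≤-refl) | ≡ᵇ-refl i = refl

  parens-column : ∀ k → parens (suc i) (column f j (k + suc (suc i))) ≡ cell (f (suc i)) (f i) j
  parens-column zero =
    trans (parens-++ (suc i) (entry f j (suc (suc i))) (column f j (suc i)))
          (trans (cong (parens (suc i) (entry f j (suc (suc i))) ++_) parens-column-low) up)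
    where
    up : parens (suc i) (entry f j (suc (suc i))) ++ cell false (f i) j ≡ cell (f (suc i)) (f i) j
    up with f (suc i)
    ... | false = refl
    ... | true rewrite ≡ᵇ-refl i = refl
  parens-column (suc k) =
    trans (parens-++ (suc i) (entry f j (suc (k + suc (suc i)))) (column f j (k + suc (suc i))))
          (cong₂ _++_ (parens-other (k + suc (suc i)) (>⇒≢ (m≤n+m (suc (suc i)) k)) (>⇒≢ (<⇒≤ (m≤n+m (suc (suc i)) k))))
                      (parens-column k))

parens-concatMap : ∀ i {up low} (g : ℕ → List (ℕ × ℕ)) → (∀ j → parens i (g j) ≡ cell (up j) (low j) j) →
                   ∀ m s h → (∀ k → h k ≡ s + k) → parens i (concatMap g (applyUpTo h m)) ≡ word up low s m
parens-concatMap i g e zero    s h _ = refl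
parens-concatMap i {up} {low} g e (suc m) s h hs rewrite hs 0 | +-identityʳ s =
  trans (parens-++ i (g s) _)
        (cong₂ _++_ (e s) (parens-concatMap i g e m (suc s) (h ∘ suc) (λ k → trans (hs (suc k)) (+-suc s k))))

rowAt : Rows → ℕ → List ℕ
rowAt B r = Maybe.fromMaybe [] (at B r)

parens-cwPos : ∀ i k B → length B ≡ k + suc (suc i) →
               parens (suc i) (cwPos B) ≡ word (λ j → memb j (rowAt B (suc i))) (λ j → memb j (rowAt B i)) 1 (maxCol B)
parens-cwPos i k B e =
  trans (cong (λ js → parens (suc i) (concatMap columnᴮ js)) (map-applyUpTo (λ x → x) suc (maxCol B)))
        (parens-concatMap (suc i) columnᴮ
           (λ j → trans (cong (λ L → parens (suc i) (column (λ r → memb j (rowAt B r)) j L)) e)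
                        (parens-column (λ r → memb j (rowAt B r)) i j k))
           (maxCol B) 1 suc (λ _ → refl))
  where
  columnᴮ : ℕ → List (ℕ × ℕ)
  columnᴮ j = column (λ r → memb j (rowAt B r)) j (length B)

-- The collapsing operator on adjacent rows

-- The column word scans columns from 1 on; a ball in column 0 would be invisible to `estar`.
Good : List ℕ → Set
Good B = Inc B × All (1 ≤_) B

at-++ : ∀ {A : Set} (P : List A) {x S} → at (P ++ x ∷ S) (length P) ≡ just x
at-++ []      = refl
at-++ (_ ∷ P) = at-++ P

at-++-suc : ∀ {A : Set} (P : List A) {x y S} → at (P ++ x ∷ y ∷ S) (suc (length P)) ≡ just y
at-++-suc []      = refl
at-++-suc (_ ∷ P) = at-++-suc P

modifyRow-++ : ∀ f P {x S} → modifyRow (suc (length P)) f (P ++ x ∷ S) ≡ P ++ f x ∷ S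
modifyRow-++ f []      = refl
modifyRow-++ f (y ∷ P) = cong (y ∷_) (modifyRow-++ f P)

modifyRow-++-suc : ∀ f P {x y S} → modifyRow (suc (suc (length P))) f (P ++ x ∷ y ∷ S) ≡ P ++ x ∷ f y ∷ S
modifyRow-++-suc f []      = refl
modifyRow-++-suc f (y ∷ P) = cong (y ∷_) (modifyRow-++-suc f P)

All-≤max : ∀ xs → All (_≤ foldr ℕ._⊔_ 0 xs) xs
All-≤max []       = []
All-≤max (x ∷ xs) = m≤m⊔n x _ ∷ All.map (λ p → ≤-trans p (m≤n⊔m x _)) (All-≤max xs)

All-≤maxCol : ∀ B → All (All (_< suc (maxCol B))) B
All-≤maxCol B = All.concat⁻ (All.map s≤s (All-≤max (concat B)))

-- Isolates all that collapsing needs to know of the column word: some sorted parenthesis word whose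
-- two kinds of parentheses are the two rows.
estar-rows : ∀ P {A B S} → All Good (P ++ A ∷ B ∷ S) →
             ∃[ p ] Sorted p × closes p ≡ A × opens p ≡ B ×
             estar (suc (length P)) (P ++ A ∷ B ∷ S) ≡ P ++ lower p ∷ upper p ∷ S
estar-rows P {A} {B} {S} good
  with (iA , pA) ∷ (iB , pB) ∷ _ ← All.++⁻ʳ P good
  with mA ∷ mB ∷ _ ← All.++⁻ʳ P (All-≤maxCol (P ++ A ∷ B ∷ S)) = p , sorted , eA , eB , eE
  where
  M = P ++ A ∷ B ∷ S
  up low : ℕ → Bool
  up j  = memb j (rowAt M (suc (length P)))
  low j = memb j (rowAt M (length P))
  p = word up low 1 (maxCol M)
  sorted = word-sorted up low 1 (maxCol M)
  eA : closes p ≡ A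
  eA = trans (closes-word up low 1 (maxCol M))
             (select-memb 1 (maxCol M) (λ j _ → cong (memb j ∘ Maybe.fromMaybe []) (at-++ P)) iA pA mA)
  eB : opens p ≡ B
  eB = trans (opens-word up low 1 (maxCol M))
             (select-memb 1 (maxCol M) (λ j _ → cong (memb j ∘ Maybe.fromMaybe []) (at-++-suc P)) iB pB mB)
  |M| : length M ≡ length S + suc (suc (length P))
  |M| = trans (length-++ P) (trans (+-comm (length P) _)
              (sym (trans (+-suc (length S) _) (cong suc (+-suc (length S) _)))))
  eU : unmatchedAbove (suc (length P)) M ≡ unm p
  eU = trans (cong (λ w → map proj₂ (filter isOpen? (unmatchedPar w))) (parens-cwPos (length P) (length S) M |M|))
             (unmatchedPar-unm p)
  eE : estar (suc (length P)) M ≡ P ++ lower p ∷ upper p ∷ S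
  eE = trans (cong (λ U → modifyRow (suc (length P)) (λ b → foldr insertSorted b U)
                            (modifyRow (suc (suc (length P))) (notIn U) M)) eU)
       (trans (cong (modifyRow (suc (length P)) (λ b → foldr insertSorted b (unm p))) (modifyRow-++-suc (notIn (unm p)) P))
       (trans (modifyRow-++ (λ b → foldr insertSorted b (unm p)) P)
              (cong₂ (λ a b → P ++ a ∷ b ∷ S)
                 (trans (cong (λ a → foldr insertSorted a (unm p)) (sym eA)) (insertAll-lower p sorted))
                 (trans (cong (notIn (unm p)) (sym eB)) (notIn-upper p sorted)))))

-- Collapsing a word to a nonwrapping queue

Linked-ʳ++ : ∀ {A : Set} {R : A → A → Set} {x} xs {acc} →
             Linked R (x ∷ xs) → Linked (flip R) (x ∷ acc) → Linked (flip R) ((x ∷ xs) ʳ++ acc)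
Linked-ʳ++ []       _        l = l
Linked-ʳ++ (y ∷ xs) (r ∷ rs) l = Linked-ʳ++ xs rs (r ∷ l)

Linked-reverse : ∀ {A : Set} {R : A → A → Set} {xs} → Linked R xs → Linked (flip R) (reverse xs)
Linked-reverse {xs = []}     _ = []
Linked-reverse {xs = x ∷ xs} l = Linked-ʳ++ xs l [-]

NonWrapping-above : ∀ {B C S} → Dom B C → NonWrapping (B ∷ S) → NonWrapping (C ∷ S)
NonWrapping-above d [-]     = [-]
NonWrapping-above {B} {C} d (_∷_ {y = Y} e l) = Dom-trans {Y} {B} {C} e d ∷ l

rw-++ : ∀ (P S : Rows) → rw (P ++ S) ≡ rw P ++ rw S
rw-++ P S = sym (concat-++ P S)

-- Qr lists the rows below X from top to bottom. The row X consists of B₀, which sits correctly between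
-- Qr and S, and of further entries counted by f; every application of estar passes entries on to the
-- next row below, in numbers that do not increase at any threshold.
eInt-flow : ∀ Qr X B₀ f S rest → Linked Dom (B₀ ∷ Qr) → NonWrapping (B₀ ∷ S) →
            (∀ j → cnt j X ≡ cnt j B₀ + f j) → (∀ {i j} → i ≤ j → f j ≤ f i) → All Good (Qr ʳ++ X ∷ S ++ rest) →
            ∃[ R ] eInt (length Qr) (Qr ʳ++ X ∷ S ++ rest) ≡ R ++ rest × NonWrapping R × All Good R ×
                   rw R ≈ rw (Qr ʳ++ X ∷ S) × length R ≡ length (Qr ʳ++ X ∷ S)
eInt-flow [] X B₀ f S rest _ up eX _ good =
  X ∷ S , refl , NonWrapping-above (λ j → subst (cnt j B₀ ≤_) (sym (eX j)) (m≤m+n _ (f j))) up ,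
  All.++⁻ˡ (X ∷ S) good , ≈refl , refl
eInt-flow (A ∷ Qr) X B₀ f S rest (d ∷ down) up eX anti good
  with p , s , refl , refl , eE ← estar-rows (reverse Qr) (subst (All Good) (ʳ++-defn Qr) good)
  -- The row below receives `unm p` as its surplus, and its old entries `closes p` take over the
  -- role of `B₀`.
  = let R , eR , nR , gR , wR , lR = eInt-flow Qr (lower p) (closes p) (λ j → cnt j (unm p)) (upper p ∷ S) rest
                                       down (upper≤ ∷ NonWrapping-above B₀≤ up) (cnt-lower p) (cnt-anti (unm p)) good′
    in
  R , trans (cong (eInt (length Qr)) estar-step) eR , nR , gR , ≈trans wR moved ,
  trans lR (trans (length-ʳ++ Qr) (sym (length-ʳ++ Qr)))
  where
  P = reverse Qr
  M = P ++ closes p ∷ opens p ∷ S ++ rest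
  estar-step : estar (suc (length Qr)) (Qr ʳ++ closes p ∷ opens p ∷ S ++ rest) ≡ Qr ʳ++ lower p ∷ upper p ∷ S ++ rest
  estar-step = trans (cong₂ (λ k → estar (suc k)) (sym (length-reverse Qr)) (ʳ++-defn Qr)) (trans eE (sym (ʳ++-defn Qr)))
  upper≤ : Dom (upper p) (closes p)
  upper≤ j = +-cancelʳ-≤ (cnt j (unm p)) _ _ (subst (_≤ cnt j (closes p) + cnt j (unm p)) (cnt-opens p j) (upper≤closes p s j))
  unm≤f : ∀ j → cnt j (unm p) ≤ f j
  unm≤f j = unm-least p s f anti j (λ i _ → subst (_≤ cnt i (closes p) + f i) (sym (eX i)) (+-monoˡ-≤ (f i) (d i)))
  -- At each threshold at most `f` entries leave the row, so those that stay still dominate `B₀`,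
  -- and through it the row above.
  B₀≤ : Dom B₀ (upper p)
  B₀≤ j = +-cancelʳ-≤ (f j) _ _ (begin
    cnt j B₀ + f j                    ≡⟨ eX j ⟨
    cnt j (opens p)                   ≡⟨ cnt-opens p j ⟩
    cnt j (upper p) + cnt j (unm p)   ≤⟨ +-monoʳ-≤ (cnt j (upper p)) (unm≤f j) ⟩
    cnt j (upper p) + f j             ∎)
  goodM = subst (All Good) (ʳ++-defn Qr) good
  good′ : All Good (Qr ʳ++ lower p ∷ upper p ∷ S ++ rest)
  good′ with (_ , pA) ∷ (_ , pB) ∷ g ← All.++⁻ʳ P goodM
        with pU , pV ← All.++⁻ (upper p) (All-resp-↭ (opens-↭ p) pB) =
    subst (All Good) (sym (ʳ++-defn Qr)) (All.++⁺ (All.++⁻ˡ P goodM)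
      ((lower-Inc s , All-resp-↭ (↭-sym (lower-↭ p)) (All.++⁺ pA pV)) ∷ (upper-Inc s , pU) ∷ g))
  moved : rw (Qr ʳ++ lower p ∷ upper p ∷ S) ≈ rw (Qr ʳ++ closes p ∷ opens p ∷ S)
  moved = ≈trans (≡⇒≈ (expand (lower p) (upper p)))
         (≈trans (≈-++ˡ (rw P) (≈-++ʳ (rw S) (≈sym (row-move-≈ p s)))) (≡⇒≈ (sym (expand (closes p) (opens p)))))
    where
    expand : ∀ A B → rw (Qr ʳ++ A ∷ B ∷ S) ≡ rw P ++ (A ++ B) ++ rw S
    expand A B = trans (cong rw (ʳ++-defn Qr)) (trans (rw-++ P (A ∷ B ∷ S)) (cong (rw P ++_) (sym (++-assoc A B (rw S)))))

collapse-row : ∀ R X Xs → NonWrapping R → All Good (R ++ X ∷ Xs) →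
               ∃[ R′ ] eInt (length R) (R ++ X ∷ Xs) ≡ R′ ++ Xs × NonWrapping R′ × All Good R′ ×
                       rw R′ ≈ rw (R ++ [ X ]) × length R′ ≡ suc (length R)
collapse-row R X Xs n good =
  -- A new top row is entirely surplus: `B₀` is empty and `f` counts all of `X`.
  let R′ , e , n′ , g′ , w , l = eInt-flow (reverse R) X [] (λ j → cnt j X) [] Xs (from-[] (Linked-reverse n)) [-] (λ _ → refl)
                                   (cnt-anti X) (subst (All Good) (sym (unreverse (X ∷ Xs))) good)
  in R′ , trans (cong₂ eInt (sym (length-reverse R)) (sym (unreverse (X ∷ Xs)))) e , n′ , g′ ,
     ≈trans w (≡⇒≈ (cong rw (unreverse [ X ]))) ,
     trans l (trans (cong length (unreverse [ X ])) (trans (length-++ R) (+-comm (length R) 1)))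
  where
  unreverse : ∀ Ys → reverse R ʳ++ Ys ≡ R ++ Ys
  unreverse Ys = trans (ʳ++-defn (reverse R)) (cong (_++ Ys) (reverse-involutive R))
  from-[] : ∀ {Q} → Linked Dom Q → Linked Dom ([] ∷ Q)
  from-[] {[]}    _ = [-]
  from-[] {_ ∷ _} l = (λ _ → z≤n) ∷ l

collapse : ∀ R Xs h → (∀ k → h k ≡ length R + k) → NonWrapping R → All Good (R ++ Xs) →
           let R′ = foldl (λ C k → eInt k C) (R ++ Xs) (applyUpTo h (length Xs)) in
           NonWrapping R′ × All Good R′ × rw R′ ≈ rw (R ++ Xs)
collapse R [] h _ n g rewrite ++-identityʳ R = n , g , ≈refl
collapse R (X ∷ Xs) h hR n g
  with R′ , e , n′ , g′ , w , l ← collapse-row R X Xs n g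
  with n″ , g″ , w″ ← collapse R′ Xs (h ∘ suc)
         (λ k → trans (hR (suc k)) (trans (+-suc (length R) k) (cong (_+ k) (sym l)))) n′
         (All.++⁺ g′ (All.tail (All.++⁻ʳ R g)))
  rewrite trans (hR 0) (+-identityʳ (length R)) | e =
  n″ , g″ , ≈trans w″ (≈trans (≡⇒≈ (rw-++ R′ Xs)) (≈trans (≈-++ʳ (rw Xs) w)
              (≡⇒≈ (trans (sym (rw-++ (R ++ [ X ]) Xs)) (cong rw (++-assoc R [ X ] Xs))))))

ρN-collapse : ∀ w → All (1 ≤_) w → NonWrapping (ρN (map [_] w)) × All Good (ρN (map [_] w)) × rw (ρN (map [_] w)) ≈ w
ρN-collapse [] _ = [] , [] , ≈refl
ρN-collapse (x ∷ w) (p ∷ ps)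
  rewrite map-applyUpTo (λ x → x) suc (length (map [_] w))
  with n , g , e ← collapse [ [ x ] ] (map [_] w) suc (λ _ → refl) [-]
                     (All.map⁺ (All.map (λ q → ([] ∷ []) , (q ∷ [])) (p ∷ ps))) =
  n , g , ≈trans e (≡⇒≈ (concat-map-[_] (x ∷ w)))

-- Removing trailing empty rows

All-reverse : ∀ {A : Set} {P : A → Set} {xs} → All P xs → All P (reverse xs)
All-reverse {xs = xs} = All-resp-↭ (↭-sym (↭-reverse xs))

rw-strip : ∀ R → rw (stripTrailing R) ≡ rw R
rw-strip R = trans (go (reverse R)) (cong rw (reverse-involutive R))
  where
  go : ∀ Q → rw (reverse (dropEmpty Q)) ≡ rw (reverse Q)
  go []            = refl
  go ([] ∷ Q)      = trans (go Q) (sym (trans (cong rw (unfold-reverse [] Q))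
                       (trans (rw-++ (reverse Q) [ [] ]) (++-identityʳ _))))
  go ((_ ∷ _) ∷ Q) = refl

-- Domination makes row lengths weakly decrease upwards, so once the top row is nonempty every row
-- is.
strip-nonWrapping : ∀ {R} → NonWrapping R → NonWrapping (stripTrailing R) × All NonEmpty (stripTrailing R)
strip-nonWrapping {R} n = let l , e = go (Linked-reverse n) in Linked-reverse l , All-reverse e
  where
  nonEmpty : ∀ {B Q} → NonEmpty B → Linked Dom (B ∷ Q) → All NonEmpty (B ∷ Q)
  nonEmpty p [-] = p ∷ []
  nonEmpty {B} p (_∷_ {y = A} d l) = p ∷ nonEmpty (≤-trans p (Dom-length {A} {B} d)) l
  go : ∀ {Q} → Linked Dom Q → Linked Dom (dropEmpty Q) × All NonEmpty (dropEmpty Q)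
  go {[]}          l = [] , []
  go {[] ∷ Q}      l = go (Linked.tail l)
  go {(_ ∷ _) ∷ Q} l = l , nonEmpty (s≤s z≤n) l

strip-All : ∀ {P : List ℕ → Set} {R} → All P R → All P (stripTrailing R)
strip-All pR = All-reverse (go (All-reverse pR))
  where
  go : ∀ {P : List ℕ → Set} {Q} → All P Q → All P (dropEmpty Q)
  go []                        = []
  go {Q = [] ∷ Q}      (_ ∷ p) = go p
  go {Q = (_ ∷ _) ∷ Q} p       = p

-- Common to members of `MLQ0` and values of `ρ`, with no reference to a partition; these properties
-- single out one queue in its Knuth class.
record Canonical (M : Rows) : Set where
  field
    nonWrapping : NonWrapping M
    nonEmpty    : All NonEmpty M
    increasing  : All Inc M

ρ-canonical : ∀ w → All (1 ≤_) w → Canonical (ρ w) × rw (ρ w) ≈ w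
ρ-canonical w p with n , g , e ← ρN-collapse w p with n′ , ne ← strip-nonWrapping n =
  record { nonWrapping = n′ ; nonEmpty = ne ; increasing = strip-All (All.map proj₁ g) } ,
  ≈trans (≡⇒≈ (rw-strip (ρN (map [_] w)))) e

-- Ferrari-Martin pairing of two rows

Labelling : Set
Labelling = List (ℕ × Maybe ℕ)

unlabelled : Labelling → List ℕ
unlabelled []                    = []
unlabelled ((c , just _) ∷ low)  = unlabelled low
unlabelled ((c , nothing) ∷ low) = c ∷ unlabelled low

setLabel-other : ∀ c ℓ low → All (c <_) (unlabelled low) → unlabelled (setLabel c ℓ low) ≡ unlabelled low
setLabel-other c ℓ [] _ = refl
setLabel-other c ℓ ((a , just _) ∷ low) q with a ≡ᵇ c
... | true  = setLabel-other c ℓ low q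
... | false = setLabel-other c ℓ low q
setLabel-other c ℓ ((a , nothing) ∷ low) (p ∷ q) rewrite ≢⇒≡ᵇ (>⇒≢ p) = cong (a ∷_) (setLabel-other c ℓ low q)

record Found (j c : ℕ) (low : Labelling) : Set where
  field
    {before after} : List ℕ
    split   : unlabelled low ≡ before ++ c ∷ after
    before< : All (_< j) before
    j≤c     : j ≤ c
    removed : ∀ ℓ → unlabelled (setLabel c ℓ low) ≡ before ++ after

firstFree-just : ∀ {j c} low → Inc (unlabelled low) → firstFreeFrom j low ≡ just c → Found j c low
firstFree-just {j} {c} ((a , just _) ∷ low) i e = record
  { split = split ; before< = before< ; j≤c = j≤c ; removed = λ ℓ → trans (labelled ℓ) (removed ℓ) }
  where
  open Found (firstFree-just low i e)
  labelled : ∀ ℓ → unlabelled (setLabel c ℓ ((a , just _) ∷ low)) ≡ unlabelled (setLabel c ℓ low)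
  labelled ℓ with a ≡ᵇ c
  ... | true  = refl
  ... | false = refl
firstFree-just {j} ((a , nothing) ∷ low) (a< ∷ i) e with j ≤ᵇ a in f
firstFree-just {j} ((a , nothing) ∷ low) (a< ∷ i) refl | true = record
  { split = refl ; before< = [] ; j≤c = ≤ᵇ⇒≤ j a (subst T (sym f) _)
  ; removed = λ ℓ → trans (here ℓ) (setLabel-other a ℓ low a<) }
  where
  here : ∀ ℓ → unlabelled (setLabel a ℓ ((a , nothing) ∷ low)) ≡ unlabelled (setLabel a ℓ low)
  here ℓ rewrite ≡ᵇ-refl a = refl
firstFree-just {j} {c} ((a , nothing) ∷ low) (a< ∷ i) e | false = record
  { split = cong (a ∷_) split ; before< = a<j ∷ before< ; j≤c = j≤c
  ; removed = λ ℓ → trans (there ℓ) (cong (a ∷_) (removed ℓ)) }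
  where
  open Found (firstFree-just low i e)
  a<j : a < j
  a<j = ≰⇒> (λ p → subst T f (≤⇒≤ᵇ p))
  there : ∀ ℓ → unlabelled (setLabel c ℓ ((a , nothing) ∷ low)) ≡ a ∷ unlabelled (setLabel c ℓ low)
  there ℓ rewrite ≢⇒≡ᵇ (<⇒≢ (<-≤-trans a<j j≤c)) = refl

firstFree-nothing : ∀ {j} low → firstFreeFrom j low ≡ nothing → All (_< j) (unlabelled low)
firstFree-nothing [] _ = []
firstFree-nothing ((a , just _) ∷ low) e = firstFree-nothing low e
firstFree-nothing {j} ((a , nothing) ∷ low) e with j ≤ᵇ a in f
... | false = ≰⇒> (λ p → subst T f (≤⇒≤ᵇ p)) ∷ firstFree-nothing low e

module _ (r : ℕ) where

  pairAll : Labelling × ℕ → List (ℕ × ℕ) → Labelling × ℕ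
  pairAll = foldl (pairBall r)

  module _ {j c : ℕ} {low : Labelling} (F : Found j c low) (i : Inc (unlabelled low)) (ℓ : ℕ) where
    open Found F

    private rest = unlabelled (setLabel c ℓ low)

    found-Inc : Inc rest
    found-Inc rewrite removed ℓ = drop-mid before (subst Inc split i)

    found-↭ : unlabelled low ↭ c ∷ rest
    found-↭ rewrite split | removed ℓ = shift c before after

    -- No unlabelled column lies in [j , c).
    found-gap : ∀ {t} → t ≤ c → cnt j rest ≤ cnt t rest
    found-gap {t} t≤c rewrite removed ℓ | cnt-++ j before after | cnt-none before< = begin
      cnt j after                     ≤⟨ cnt-length j after ⟩
      length after                    ≡⟨ cnt-all (All.map (λ p → ≤-trans t≤c (<⇒≤ p))
                                           (AllPairs.head (AllPairs-++⁻ʳ before (subst Inc split i)))) ⟨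
      cnt t after                     ≤⟨ m≤n+m _ _ ⟩
      cnt t before + cnt t after      ≡⟨ cnt-++ t before after ⟨
      cnt t (before ++ after)         ∎

  -- Valid for every order of the balls. Taking the first free column `c` right of `j` could only
  -- harm a threshold in `(j , c]`, and there no free column is lost compared with threshold `j`, by
  -- `found-gap`.
  pairAll-dominated : ∀ os low m → Inc (unlabelled low) → Dom (map proj₁ os) (unlabelled low) →
                      proj₂ (pairAll (low , m) os) ≡ m
  pairAll-dominated [] low m _ _ = refl
  pairAll-dominated ((j , ℓ) ∷ os) low m i d with firstFreeFrom j low in e
  ... | nothing = contradiction (≤-trans (≤-reflexive (sym (cnt-≤ (map proj₁ os) (≤-refl {j}))))
                    (≤-trans (d j) (≤-reflexive (cnt-none (firstFree-nothing low e))))) λ ()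
  ... | just c = pairAll-dominated os (setLabel c ℓ low) m (found-Inc F i ℓ) d′
    where
    F = firstFree-just low i e
    open Found F using (j≤c)
    rest = unlabelled (setLabel c ℓ low)
    total : ∀ t → cnt t (j ∷ map proj₁ os) ≤ cnt t (c ∷ rest)
    total t = ≤-trans (d t) (≤-reflexive (cnt-↭ t (found-↭ F i ℓ)))
    below : ∀ t → t ≤ j → cnt t (map proj₁ os) ≤ cnt t rest
    below t t≤j = s≤s⁻¹ (subst₂ _≤_ (cnt-≤ (map proj₁ os) t≤j) (cnt-≤ rest (≤-trans t≤j j≤c)) (total t))
    d′ : Dom (map proj₁ os) rest
    d′ t with ≤-<-connex t j | ≤-<-connex t c
    ... | inj₁ t≤j | _ = below t t≤j
    ... | inj₂ j<t | inj₂ c<t = subst₂ _≤_ (cnt-> (map proj₁ os) j<t) (cnt-> rest c<t) (total t)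
    ... | inj₂ j<t | inj₁ t≤c = begin
      cnt t (map proj₁ os)  ≤⟨ cnt-anti (map proj₁ os) (<⇒≤ j<t) ⟩
      cnt j (map proj₁ os)  ≤⟨ below j ≤-refl ⟩
      cnt j rest            ≤⟨ found-gap F i ℓ t≤c ⟩
      cnt t rest            ∎

  pairBall-≥ : ∀ s b → proj₂ s ≤ proj₂ (pairBall r s b)
  pairBall-≥ (low , m) (j , ℓ) with firstFreeFrom j low
  ... | just c = ≤-refl
  ... | nothing with firstFreeFrom 0 low
  ...   | just c  = m≤m+n m _
  ...   | nothing = ≤-refl

  pairAll-≥ : ∀ s os → proj₂ s ≤ proj₂ (pairAll s os)
  pairAll-≥ s []       = ≤-refl
  pairAll-≥ s (b ∷ os) = ≤-trans (pairBall-≥ s b) (pairAll-≥ (pairBall r s b) os)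

  -- A wrap costs at least 1 because `r ≤ ℓ`. A ball that finds no free column at all would cost
  -- nothing; the bound on lengths excludes it.
  pairAll-0 : ∀ os low m → Inc (unlabelled low) → All (λ b → r ≤ proj₂ b) os → length os ≤ length (unlabelled low) →
              proj₂ (pairAll (low , m) os) ≡ 0 → Dom (map proj₁ os) (unlabelled low)
  pairAll-0 [] _ _ _ _ _ _ t = z≤n
  pairAll-0 ((j , ℓ) ∷ os) low m i (r≤ℓ ∷ ls) l z t with firstFreeFrom j low in e
  ... | just c = subst (cnt t (j ∷ map proj₁ os) ≤_) (sym (cnt-↭ t (found-↭ F i ℓ))) step
    where
    F = firstFree-just low i e
    open Found F using (j≤c)
    rest = unlabelled (setLabel c ℓ low)
    ih : cnt t (map proj₁ os) ≤ cnt t rest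
    ih = pairAll-0 os (setLabel c ℓ low) m (found-Inc F i ℓ) ls
           (s≤s⁻¹ (subst (suc (length os) ≤_) (↭-length (found-↭ F i ℓ)) l)) z t
    step : cnt t (j ∷ map proj₁ os) ≤ cnt t (c ∷ rest)
    step with ≤-<-connex t j
    ... | inj₁ t≤j rewrite cnt-≤ (map proj₁ os) t≤j | cnt-≤ rest (≤-trans t≤j j≤c) = s≤s ih
    ... | inj₂ j<t rewrite cnt-> (map proj₁ os) j<t = ≤-trans ih (cnt-tail t c rest)
  ... | nothing with firstFreeFrom 0 low in f
  ...   | just c = contradiction (begin-strict
      0                                     <⟨ m<n⇒0<n∸m (subst (r <_) (+-comm 1 ℓ) (s≤s r≤ℓ)) ⟩
      ℓ + 1 ∸ r                             ≤⟨ m≤n+m _ m ⟩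
      m + (ℓ + 1 ∸ r)                       ≤⟨ pairAll-≥ (setLabel c ℓ low , m + (ℓ + 1 ∸ r)) os ⟩
      proj₂ (pairAll (setLabel c ℓ low , m + (ℓ + 1 ∸ r)) os) ≡⟨ z ⟩
      0                                     ∎) λ ()
  ...   | nothing with unlabelled low | firstFree-nothing {0} low f | l
  ...     | [] | [] | ()

  module _ {P : ℕ → Set} where

    Labels : Labelling → Set
    Labels = All (λ p → Maybe.All P (proj₂ p))

    setLabel-Labels : ∀ c {ℓ} → P ℓ → ∀ {low} → Labels low → Labels (setLabel c ℓ low)
    setLabel-Labels c pℓ [] = []
    setLabel-Labels c pℓ {(a , _) ∷ _} (p ∷ ps) with a ≡ᵇ c
    ... | true  = Maybe.just pℓ ∷ setLabel-Labels c pℓ ps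
    ... | false = p ∷ setLabel-Labels c pℓ ps

    pairBall-Labels : ∀ s b → P (proj₂ b) → Labels (proj₁ s) → Labels (proj₁ (pairBall r s b))
    pairBall-Labels (low , m) (j , ℓ) pℓ ps with firstFreeFrom j low
    ... | just c = setLabel-Labels c pℓ ps
    ... | nothing with firstFreeFrom 0 low
    ...   | just c  = setLabel-Labels c pℓ ps
    ...   | nothing = ps

    pairAll-Labels : ∀ s os → All (λ b → P (proj₂ b)) os → Labels (proj₁ s) → Labels (proj₁ (pairAll s os))
    pairAll-Labels s []       []       q = q
    pairAll-Labels s (b ∷ os) (p ∷ ps) q = pairAll-Labels (pairBall r s b) os ps (pairBall-Labels s b p q)

  setLabel-columns : ∀ c ℓ low → map proj₁ (setLabel c ℓ low) ≡ map proj₁ low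
  setLabel-columns c ℓ [] = refl
  setLabel-columns c ℓ ((a , _) ∷ low) with a ≡ᵇ c
  ... | true  = cong (a ∷_) (setLabel-columns c ℓ low)
  ... | false = cong (a ∷_) (setLabel-columns c ℓ low)

  pairBall-columns : ∀ s b → map proj₁ (proj₁ (pairBall r s b)) ≡ map proj₁ (proj₁ s)
  pairBall-columns (low , m) (j , ℓ) with firstFreeFrom j low
  ... | just c = setLabel-columns c ℓ low
  ... | nothing with firstFreeFrom 0 low
  ...   | just c  = setLabel-columns c ℓ low
  ...   | nothing = refl

  pairAll-columns : ∀ s os → map proj₁ (proj₁ (pairAll s os)) ≡ map proj₁ (proj₁ s)
  pairAll-columns s []       = refl
  pairAll-columns s (b ∷ os) = trans (pairAll-columns (pairBall r s b) os) (pairBall-columns s b)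

-- The balls in order of decreasing label

byLabel : ℕ → List (ℕ × ℕ) → ℕ → List (ℕ × ℕ)
byLabel r us m = concatMap (λ ℓ → filter (λ b → ℓ ℕ.≟ proj₂ b) us) (map (λ k → k + r) (downFrom m))

byLabel-[] : ∀ r m → byLabel r [] m ≡ []
byLabel-[] r zero    = refl
byLabel-[] r (suc m) = byLabel-[] r m

byLabel-skip : ∀ {r u} us m → m + r ≤ proj₂ u → byLabel r (u ∷ us) m ≡ byLabel r us m
byLabel-skip us zero    _ = refl
byLabel-skip {r} {u} us (suc m) p =
  cong₂ _++_ (filter-reject (λ b → m + r ℕ.≟ proj₂ b) (<⇒≢ p)) (byLabel-skip us m (<⇒≤ p))

byLabel-∷ : ∀ {r u} us m → r ≤ proj₂ u → proj₂ u < m + r → byLabel r (u ∷ us) m ↭ u ∷ byLabel r us m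
byLabel-∷ us zero p q = contradiction p (<⇒≱ q)
byLabel-∷ {r} {u} us (suc m) p q with m + r ℕ.≟ proj₂ u
... | yes e = Perm.↭-reflexive (cong₂ _++_ (filter-accept (λ b → m + r ℕ.≟ proj₂ b) e) (byLabel-skip us m (≤-reflexive e)))
... | no e  = ↭-trans (Perm.↭-reflexive (cong (_++ byLabel r (u ∷ us) m) (filter-reject (λ b → m + r ℕ.≟ proj₂ b) e)))
             (↭-trans (++⁺ˡ (filter (λ b → m + r ℕ.≟ proj₂ b) us) (byLabel-∷ us m p (≤∧≢⇒< (s≤s⁻¹ q) (e ∘ sym))))
                      (shift u (filter (λ b → m + r ℕ.≟ proj₂ b) us) (byLabel r us m)))

LabelsIn : ℕ → ℕ → List (ℕ × ℕ) → Set
LabelsIn r L = All (λ b → r ≤ proj₂ b × proj₂ b ≤ L)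

-- The filters run through the labels from `L` down to `r`, so each ball is listed once. Only this
-- permutation is used, since `Dom` ignores order.
byLabel-↭ : ∀ {r L us} → LabelsIn r L us → byLabel r us (L + 1 ∸ r) ↭ us
byLabel-↭ {r} {L} {[]} _ = Perm.↭-reflexive (byLabel-[] r (L + 1 ∸ r))
byLabel-↭ {r} {L} {u ∷ us} ((p , q) ∷ ps) = ↭-trans (byLabel-∷ us (L + 1 ∸ r) p u<) (prep u (byLabel-↭ ps))
  where
  u< : proj₂ u < L + 1 ∸ r + r
  u< = ≤-trans (s≤s q) (≤-trans (≤-reflexive (+-comm 1 L)) (≤-reflexive (sym (m∸n+n≡m (≤-trans p (≤-trans q (m≤m+n L 1)))))))

unlabelled-fresh : ∀ B → unlabelled (map (λ c → c , nothing) B) ≡ B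
unlabelled-fresh []      = refl
unlabelled-fresh (b ∷ B) = cong (b ∷_) (unlabelled-fresh B)

columns-fresh : ∀ B → map proj₁ (map {B = ℕ × Maybe ℕ} (λ c → c , nothing) B) ≡ B
columns-fresh []      = refl
columns-fresh (b ∷ B) = cong (b ∷_) (columns-fresh B)

module _ {r L : ℕ} (us : List (ℕ × ℕ)) (B : List ℕ) where

  private
    fresh : Labelling
    fresh = map (λ c → c , nothing) B
    os = byLabel r us (L + 1 ∸ r)
    res = pairAll r (fresh , 0) os

  pairRow-columns : map proj₁ (proj₁ (pairRow r L us B)) ≡ B
  pairRow-columns = trans (sym (map-∘ (proj₁ res))) (trans (pairAll-columns r (fresh , 0) os) (columns-fresh B))

  pairRow-labels : r ≤ L → LabelsIn r L us → LabelsIn (r ∸ 1) L (proj₁ (pairRow r L us B))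
  pairRow-labels r≤L ls = finish (pairAll-Labels r (fresh , 0) os (All-resp-↭ (↭-sym (byLabel-↭ ls)) ls) (none B))
    where
    none : ∀ B → Labels r {λ ℓ → r ≤ ℓ × ℓ ≤ L} (map (λ c → c , nothing) B)
    none []      = []
    none (_ ∷ B) = Maybe.nothing ∷ none B
    finish : ∀ {low} → Labels r {λ ℓ → r ≤ ℓ × ℓ ≤ L} low →
             LabelsIn (r ∸ 1) L (map (λ p → proj₁ p , Maybe.fromMaybe (r ∸ 1) (proj₂ p)) low)
    finish [] = []
    finish (Maybe.just (p , q) ∷ ps) = (≤-trans (m∸n≤m r 1) p , q) ∷ finish ps
    finish (Maybe.nothing ∷ ps)      = (≤-refl , ≤-trans (m∸n≤m r 1) r≤L) ∷ finish ps

  module _ (iB : Inc B) (ls : LabelsIn r L us) where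

    private
      iFresh : Inc (unlabelled fresh)
      iFresh = subst Inc (sym (unlabelled-fresh B)) iB
      columns-↭ : map proj₁ os ↭ map proj₁ us
      columns-↭ = map⁺ proj₁ (byLabel-↭ ls)

    pairRow-dominated : Dom (map proj₁ us) B → proj₂ (pairRow r L us B) ≡ 0
    pairRow-dominated d = pairAll-dominated r os fresh 0 iFresh λ t →
      subst₂ _≤_ (sym (cnt-↭ t columns-↭)) (sym (cong (cnt t) (unlabelled-fresh B))) (d t)

    pairRow-0 : length (map proj₁ us) ≤ length B → proj₂ (pairRow r L us B) ≡ 0 → Dom (map proj₁ us) B
    pairRow-0 l z t = subst₂ _≤_ (cnt-↭ t columns-↭) (cong (cnt t) (unlabelled-fresh B))
      (pairAll-0 r os fresh 0 iFresh (All.map proj₁ (All-resp-↭ (↭-sym (byLabel-↭ ls)) ls))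
        (subst₂ _≤_ (trans (length-map proj₁ us) (sym (↭-length (byLabel-↭ ls)))) (cong length (sym (unlabelled-fresh B))) l) z t)

-- Vanishing of maj for a whole queue

majGo-dominated : ∀ {L r us} Bs → r ≤ L → LabelsIn r L us → All Inc Bs → Linked Dom (map proj₁ us ∷ Bs) → majGo L r us Bs ≡ 0
majGo-dominated [] _ _ _ _ = refl
majGo-dominated {L} {r} {us} (B ∷ Bs) r≤L ls (iB ∷ i) (d ∷ l) =
  cong₂ _+_ (pairRow-dominated us B iB ls d)
    (majGo-dominated Bs (≤-trans (m∸n≤m r 1) r≤L) (pairRow-labels us B r≤L ls) i
      (subst (λ C → Linked Dom (C ∷ Bs)) (sym (pairRow-columns {r} {L} us B)) l))

majGo-0 : ∀ {L r us} Bs → r ≤ L → LabelsIn r L us → All Inc Bs → Linked (λ A B → length A ≤ length B) (map proj₁ us ∷ Bs) →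
          majGo L r us Bs ≡ 0 → Linked Dom (map proj₁ us ∷ Bs)
majGo-0 [] _ _ _ _ _ = [-]
majGo-0 {L} {r} {us} (B ∷ Bs) r≤L ls (iB ∷ i) (q ∷ l) z =
  pairRow-0 us B iB ls q (m+n≡0⇒m≡0 _ z) ∷
  subst (λ C → Linked Dom (C ∷ Bs)) (pairRow-columns {r} {L} us B)
    (majGo-0 Bs (≤-trans (m∸n≤m r 1) r≤L) (pairRow-labels us B r≤L ls) i
      (subst (λ C → Linked _ (C ∷ Bs)) (sym (pairRow-columns {r} {L} us B)) l) (m+n≡0⇒n≡0 (proj₂ (pairRow r L us B)) z))

topRow : ∀ L B → LabelsIn L L (map (λ c → c , L) B) × map proj₁ (map (λ c → c , L) B) ≡ B
topRow L []      = [] , refl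
topRow L (b ∷ B) with ls , e ← topRow L B = (≤-refl , ≤-refl) ∷ ls , cong (b ∷_) e

nonWrapping⇒maj≡0 : ∀ M → All Inc M → NonWrapping M → maj M ≡ 0
nonWrapping⇒maj≡0 M i n with reverse M | All-reverse i | Linked-reverse n
... | []     | _      | _ = refl
... | B ∷ Bs | _ ∷ iB | l with ls , e ← topRow (length M) B =
  majGo-dominated Bs ≤-refl ls iB (subst (λ C → Linked Dom (C ∷ Bs)) (sym e) l)

maj≡0⇒nonWrapping : ∀ M → All Inc M → Linked (λ A B → length A ≥ length B) M → maj M ≡ 0 → NonWrapping M
maj≡0⇒nonWrapping M i n z = subst NonWrapping (reverse-involutive M) (Linked-reverse (down M i n z))
  where
  down : ∀ M → All Inc M → Linked (λ A B → length A ≥ length B) M → maj M ≡ 0 → Linked Dom (reverse M)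
  down M i n z with reverse M | All-reverse i | Linked-reverse n
  ... | []     | _      | _ = []
  ... | B ∷ Bs | _ ∷ iB | l with ls , e ← topRow (length M) B =
    subst (λ C → Linked Dom (C ∷ Bs)) e
      (majGo-0 Bs ≤-refl ls iB (subst (λ C → Linked _ (C ∷ Bs)) (sym e) l) z)

-- The reverse complement

rc : ℕ → List ℕ → List ℕ
rc N w = reverse (map (N ∸_) w)

rc-∷ : ∀ N x w → rc N (x ∷ w) ≡ rc N w ++ [ N ∸ x ]
rc-∷ N x w = unfold-reverse (N ∸ x) (map (N ∸_) w)

rc-++ : ∀ N u v → rc N (u ++ v) ≡ rc N v ++ rc N u
rc-++ N u v = trans (cong reverse (map-++ (N ∸_) u v)) (reverse-++ (map (N ∸_) u) (map (N ∸_) v))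

rc-involutive : ∀ {N w} → All (_≤ N) w → rc N (rc N w) ≡ w
rc-involutive {N} {w} p = trans (cong reverse (reverse-map (N ∸_) (map (N ∸_) w)))
  (trans (reverse-involutive _) (twice p))
  where
  twice : ∀ {w} → All (_≤ N) w → map (N ∸_) (map (N ∸_) w) ≡ w
  twice []       = refl
  twice (p ∷ ps) = cong₂ _∷_ (m∸[m∸n]≡n p) (twice ps)

-- Reversal together with complementation exchanges the two Knuth relations; the bound `N` keeps
-- truncated subtraction strictly decreasing.
rc-≈ : ∀ {N u v} → All (_≤ N) u → u ≈ v → rc N u ≈ rc N v
rc-≈ {N} (_ ∷ _ ∷ y≤N ∷ _) (k₁ {x} {y} {z} x<y y≤z s) =
  ≈trans (≡⇒≈ (rc-++ N (x ∷ z ∷ y ∷ []) s))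
  (≈trans (≈-++ˡ (rc N s) (≈sym (k₂ (∸-monoʳ-≤ N y≤z) (∸-monoʳ-< x<y y≤N) [])))
          (≡⇒≈ (sym (rc-++ N (z ∷ x ∷ y ∷ []) s))))
rc-≈ {N} (_ ∷ z≤N ∷ _) (k₂ {x} {y} {z} x≤y y<z s) =
  ≈trans (≡⇒≈ (rc-++ N (y ∷ z ∷ x ∷ []) s))
  (≈trans (≈-++ˡ (rc N s) (≈sym (k₁ (∸-monoʳ-< y<z z≤N) (∸-monoʳ-≤ N x≤y) [])))
          (≡⇒≈ (sym (rc-++ N (y ∷ x ∷ z ∷ []) s))))
rc-≈ {N} (_ ∷ p) (cons x {u} {v} e) =
  ≈trans (≡⇒≈ (rc-∷ N x u)) (≈trans (≈-++ʳ [ N ∸ x ] (rc-≈ p e)) (≡⇒≈ (sym (rc-∷ N x v))))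
rc-≈ p ≈refl        = ≈refl
rc-≈ p (≈sym e)     = ≈sym (rc-≈ (All-resp-↭ (≈⇒↭ (≈sym e)) p) e)
rc-≈ p (≈trans e f) = ≈trans (rc-≈ p e) (rc-≈ (All-resp-↭ (≈⇒↭ e) p) f)

-- The 180° rotation of a canonical queue is a tableau

Decr : List ℕ → Set
Decr = AllPairs _>_

Inc-reverse : ∀ {B} → Inc B → Decr (reverse B)
Inc-reverse i = Linked.Linked⇒AllPairs (flip <-trans) (Linked-reverse (Linked.AllPairs⇒Linked i))

-- Domination on final segments amounts to comparing the k-th largest entries for every k, hence the
-- decreasing order.
Dom⇒Prefix : ∀ {A B} → Decr A → Decr B → Dom B A → Prefix _≤_ B A
Dom⇒Prefix {_} {[]} _ _ _ = []
Dom⇒Prefix {[]} {b ∷ B} _ _ d with () ← ≤-trans (≤-reflexive (sym (cnt-≤ B (≤-refl {b})))) (d b)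
Dom⇒Prefix {a ∷ A} {b ∷ B} (Aa ∷ iA) (Bb ∷ iB) d with ≤-<-connex b a
... | inj₂ a<b with () ← ≤-trans (≤-reflexive (sym (cnt-≤ B (≤-refl {b}))))
                           (≤-trans (d b) (≤-reflexive (cnt-none (a<b ∷ All.map (λ p → <-trans p a<b) Aa))))
... | inj₁ b≤a = b≤a ∷ Dom⇒Prefix iA iB d′
  where
  d′ : Dom B A
  d′ t with ≤-<-connex t b
  ... | inj₁ t≤b = s≤s⁻¹ (subst₂ _≤_ (cnt-≤ B t≤b) (cnt-≤ A (≤-trans t≤b b≤a)) (d t))
  ... | inj₂ b<t = subst (_≤ cnt t A) (sym (cnt-none (All.map (λ p → <-trans p b<t) Bb))) z≤n

module _ (N : ℕ) where

  Prefix-complement : ∀ {A B} → Prefix _≤_ B A → map (N ∸_) A ⊵ map (N ∸_) B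
  Prefix-complement []       = []
  Prefix-complement (p ∷ ps) = ∸-monoʳ-≤ N p ∷ Prefix-complement ps

  rc-⊵ : ∀ {A B} → Inc A → Inc B → Dom B A → rc N A ⊵ rc N B
  rc-⊵ {A} {B} iA iB d = subst₂ _⊵_ (reverse-map (N ∸_) A) (reverse-map (N ∸_) B)
    (Prefix-complement (Dom⇒Prefix (Inc-reverse iA) (Inc-reverse iB) λ t →
      subst₂ _≤_ (cnt-↭ t (↭-sym (↭-reverse B))) (cnt-↭ t (↭-sym (↭-reverse A))) (d t)))

  complement-Inc : ∀ {D} → Decr D → All (_≤ N) D → Inc (map (N ∸_) D)
  complement-Inc []        []       = []
  complement-Inc (q ∷ qs)  (p ∷ ps) = All.map⁺ (All.map (λ r → ∸-monoʳ-< r p) q) ∷ complement-Inc qs ps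

  rc-Inc : ∀ {B} → Inc B → All (_≤ N) B → Inc (rc N B)
  rc-Inc {B} i p = subst Inc (reverse-map (N ∸_) B) (complement-Inc (Inc-reverse i) (All-reverse p))

  rotate : Rows → Rows
  rotate = map (rc N)

  rotate-revcrw : ∀ M → revcrw (rotate M) ≡ rc N (rw M)
  rotate-revcrw M = cong reverse (trans (cong concat (trans (sym (map-∘ M)) (map-cong (λ B → reverse-involutive (map (N ∸_) B)) M)))
                                        (concat-map M))

  rotate-⊵ : ∀ {M} → All Inc M → NonWrapping M → Linked _⊵_ (rotate M)
  rotate-⊵ _              []      = []
  rotate-⊵ _              [-]     = [-]
  rotate-⊵ (iA ∷ iB ∷ i) (d ∷ l) = rc-⊵ iA iB d ∷ rotate-⊵ (iB ∷ i) l

  Icol-rotate : ∀ {M} → Canonical M → All (All (_≤ N)) M → Icol (rc N (rw M)) ≡ rotate M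
  Icol-rotate {M} can p = trans (cong Icol (sym (rotate-revcrw M)))
    (Icol-revcrw (rotate M) (All.map⁺ (All.zipWith (λ (i , q) → rc-Inc i q) (increasing , p)))
       (All.map⁺ (All.map (λ {B} → subst (0 <_) (sym (trans (length-reverse (map (N ∸_) B)) (length-map (N ∸_) B)))) nonEmpty))
       (rotate-⊵ increasing nonWrapping))
    where open Canonical can

  rotate-involutive : ∀ {M} → All (All (_≤ N)) M → rotate (rotate M) ≡ M
  rotate-involutive []       = refl
  rotate-involutive (p ∷ ps) = cong₂ _∷_ (rc-involutive p) (rotate-involutive ps)

-- By Icol-rotate the rotated queues are insertion tableaux of Knuth equivalent words.
canonical-unique : ∀ {N M M′} → All (All (_≤ N)) M → Canonical M → Canonical M′ → rw M ≈ rw M′ → M ≡ M′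
canonical-unique {N} {M} {M′} p can can′ e =
  trans (sym (rotate-involutive N p)) (trans (cong (rotate N) same) (rotate-involutive N p′))
  where
  p′ : All (All (_≤ N)) M′
  p′ = All.concat⁻ (All-resp-↭ (≈⇒↭ e) (All.concat⁺ p))
  same : rotate N M ≡ rotate N M′
  same = trans (sym (Icol-rotate N can p)) (trans (Icol-≈ (rc-≈ (All.concat⁺ p) e)) (Icol-rotate N can′ p′))

-- The conjugate partition

-- The entries of `conj la` are by definition the numbers `cnt (suc i) la`.
conj-decreasing : ∀ la → Linked _≥_ (conj la)
conj-decreasing la = Linked.map⁺ (Linked.map⁺ (Linked.applyUpTo⁺₂ (λ x → x) (λ₁ la) λ i → cnt-anti la (n≤1+n (suc i))))

conj-positive : ∀ la → All (0 <_) (conj la)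
conj-positive []       = []
conj-positive (x ∷ la) = All.map⁺ (All.map⁺ (All.applyUpTo⁺₁ (λ i → i) x λ {i} i<x →
  subst (0 <_) (sym (cnt-≤ {suc i} la i<x)) (s≤s z≤n)))

-- The two inverse maps

revcrw-↭ : ∀ T → revcrw T ↭ rw T
revcrw-↭ []      = ↭-refl
revcrw-↭ (c ∷ T) = ↭-trans (Perm.↭-reflexive (revcrw-∷ c T))
  (↭-trans (++-comm (revcrw T) c) (++⁺ˡ c (revcrw-↭ T)))

Increasing⇒Linked : ∀ {M : Rows} → All Inc M → All (Linked _<_) M
Increasing⇒Linked = All.map λ i → Linked.AllPairs⇒Linked i

Linked⇒Increasing : ∀ {M : Rows} → All (Linked _<_) M → All Inc M
Linked⇒Increasing = All.map λ l → Linked.Linked⇒AllPairs <-trans l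

module _ {la : List ℕ} {n : ℕ} where

  lengths⇒nonEmpty : ∀ {M : Rows} → map length M ≡ conj la → All NonEmpty M
  lengths⇒nonEmpty e = All.map⁻ (subst (All (0 <_)) (sym e) (conj-positive la))

  lengths⇒decreasing : ∀ {M : Rows} → map length M ≡ conj la → Linked (λ A B → length A ≥ length B) M
  lengths⇒decreasing e = Linked.map⁻ (subst (Linked _≥_) (sym e) (conj-decreasing la))

  MLQ0⇒canonical : ∀ {M} → MLQ0 la n M → Canonical M
  MLQ0⇒canonical {M} (e , _ , i , z) = record
    { nonWrapping = maj≡0⇒nonWrapping M inc (lengths⇒decreasing e) z
    ; nonEmpty = lengths⇒nonEmpty e ; increasing = inc }
    where
    inc : All Inc M
    inc = Linked⇒Increasing i

  SSYT⇒tableau : ∀ {T} → SSYT la n T → All Inc T × All NonEmpty T × Linked _⊵_ T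
  SSYT⇒tableau {T} (e , _ , i , l) =
    Linked⇒Increasing i , lengths⇒nonEmpty e , link (lengths⇒decreasing e) l
    where
    link : ∀ {T : Rows} → Linked (λ A B → length A ≥ length B) T → Linked RowWeak T → Linked _⊵_ T
    link [] _ = []
    link [-] _ = [-]
    link (p ∷ ps) (q ∷ qs) = RowWeak⇒⊵ _ _ p q ∷ link ps qs

mlq-canonical : ∀ T → All (All (1 ≤_)) T → Canonical (mlq T) × rw (mlq T) ≈ revcrw T
mlq-canonical T p = ρ-canonical (revcrw T) (All-resp-↭ (↭-sym (revcrw-↭ T)) (All.concat⁺ p))

theoremA4 : (la : List ℕ) (n : ℕ) → IsPartition la → length la ≤ n →
    ((T : Rows) → SSYT la n T → MLQ0 la n (mlq T) × tab (mlq T) ≡ T) ×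
    ((M : Rows) → MLQ0 la n M → SSYT la n (tab M) × mlq (tab M) ≡ M)
theoremA4 la n _ _ = from-tableau , from-queue
  where
  from-tableau : (T : Rows) → SSYT la n T → MLQ0 la n (mlq T) × tab (mlq T) ≡ T
  from-tableau T ssyt@(e , range , _) =
    -- Row lengths are not followed through collapsing: those of `mlq T` are the column lengths of
    -- `tab (mlq T)`, which is `T` by `back`.
    (trans (sym (Icol-shape (mlq T) increasing nonEmpty nonWrapping)) (trans (cong (map length) back) e) ,
     All.concat⁻ (All-resp-↭ (↭-sym (↭-trans (≈⇒↭ eq) (revcrw-↭ T))) (All.concat⁺ range)) ,
     Increasing⇒Linked increasing , nonWrapping⇒maj≡0 (mlq T) increasing nonWrapping) , back
    where
    can = mlq-canonical T (All.map (All.map proj₁) range)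
    open Canonical (proj₁ can)
    eq : rw (mlq T) ≈ revcrw T
    eq = proj₂ can
    back : tab (mlq T) ≡ T
    back with i , ne , l ← SSYT⇒tableau {la} {n} ssyt = trans (Icol-≈ eq) (Icol-revcrw T i ne l)
  from-queue : (M : Rows) → MLQ0 la n M → SSYT la n (tab M) × mlq (tab M) ≡ M
  from-queue M q@(e , range , _) =
    (trans (Icol-shape M increasing nonEmpty nonWrapping) e , range′ ,
     Increasing⇒Linked (⇐-Inc (rw M) [] []) , Linked.map ⊵⇒RowWeak (⇐-tableau (rw M) [] [])) ,
    sym (canonical-unique (All.map (All.map proj₂) range) (MLQ0⇒canonical {la} {n} q) (proj₁ can)
          (≈trans (≈-revcrw-Icol (rw M)) (≈sym (proj₂ can))))
    where
    open Canonical (MLQ0⇒canonical {la} {n} q)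
    range′ : All (All (InRange n)) (tab M)
    range′ = All.concat⁻ (All-resp-↭ (↭-trans (≈⇒↭ (≈-revcrw-Icol (rw M))) (revcrw-↭ (tab M))) (All.concat⁺ range))
    can = mlq-canonical (tab M) (All.map (All.map proj₁) range′)
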